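{- Let $G$ be a double tree. Then there is a spanning tree factorization $(T_1,T_2)$ of $G$ such that $|d_{T_1}(v)-d_{T_2}(v)|\leq 5$ for all $v \in V(G)$.
   Context: Graphs are finite and may have parallel edges. For a positive integer $k$, a graph $G$ is a $k$-multiple tree if there are spanning trees $T_1,\ldots,T_k$ of $G$ that are pairwise edge-disjoint and satisfy $E(T_1)\cup\cdots\cup E(T_k)=E(G)$; the tuple $(T_1,\ldots,T_k)$ is then called a spanning tree factorization of $G$. A double tree is a $2$-multiple tree. For a subgraph $T$ and vertex $v$, $d_T(v)$ denotes the number of edges of $T$ incident to $v$. -}

module Defs where

open import Data.Nat using (ℕ; zero; suc; _+_; _∸_; _≤_; ∣_-_∣)
open import Data.Fin using (Fin; zero; suc)
open import Data.Bool using (Bool; true; false; not; if_then_else_)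
open import Data.Product using (Σ; _×_; _,_; proj₁; proj₂; ∃-syntax)
open import Data.Sum using (_⊎_)
open import Data.List using (List; []; _∷_; length)
open import Data.List.Relation.Unary.Unique.Propositional using (Unique)
open import Relation.Binary.PropositionalEquality using (_≡_)
open import Relation.Nullary using (¬_)

-- A finite multigraph (parallel edges and loops allowed) with vertex set
-- Fin n and edge set Fin m; each edge has two (unordered) endpoints.
record Graph : Set where
  field
    n : ℕ
    m : ℕ
    ends : Fin m → Fin n × Fin n
open Graph public

Vertex : Graph → Set
Vertex G = Fin (n G)

Edge : Graph → Set
Edge G = Fin (m G)

Joins : (G : Graph) → Edge G → Vertex G → Vertex G → Set
Joins G e u v =
  (proj₁ (ends G e) ≡ u × proj₂ (ends G e) ≡ v) ⊎
  (proj₁ (ends G e) ≡ v × proj₂ (ends G e) ≡ u)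

-- A spanning subgraph of G, given by its edge set.
EdgeSet : Graph → Set
EdgeSet G = Edge G → Bool

data Walk (G : Graph) (S : EdgeSet G) : Vertex G → Vertex G → List (Edge G) → List (Vertex G) → Set where
  stop : ∀ {u} → Walk G S u u [] []
  step : ∀ {u w v es vs} (e : Edge G) → S e ≡ true → Joins G e u w →
         Walk G S w v es vs → Walk G S u v (e ∷ es) (u ∷ vs)

Connected : (G : Graph) → EdgeSet G → Set
Connected G S = ∀ (u v : Vertex G) → ∃[ es ] ∃[ vs ] Walk G S u v es vs

-- A cycle in (V(G), S): a closed walk of length ≥ 1 with pairwise distinct
-- edges and pairwise distinct vertices (apart from start = end).
-- (Loops give cycles of length 1, parallel edges cycles of length 2.)
Cycle : (G : Graph) → EdgeSet G → Set
Cycle G S = ∃[ u ] ∃[ e ] ∃[ es ] ∃[ vs ]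
  (Walk G S u u (e ∷ es) vs × Unique (e ∷ es) × Unique vs)

Acyclic : (G : Graph) → EdgeSet G → Set
Acyclic G S = ¬ Cycle G S

SpanningTree : (G : Graph) → EdgeSet G → Set
SpanningTree G S = Connected G S × Acyclic G S

IsFactorization₂ : (G : Graph) → EdgeSet G → EdgeSet G → Set
IsFactorization₂ G T₁ T₂ =
  SpanningTree G T₁ × SpanningTree G T₂ × (∀ e → T₂ e ≡ not (T₁ e))

DoubleTree : Graph → Set
DoubleTree G = ∃[ T₁ ] ∃[ T₂ ] IsFactorization₂ G T₁ T₂

open import Data.Fin using (_≟_)
open import Relation.Nullary using (does)
open import Data.Bool using (_∨_; _∧_)

incident : (G : Graph) → Edge G → Vertex G → Bool
incident G e v = does (proj₁ (ends G e) ≟ v) ∨ does (proj₂ (ends G e) ≟ v)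

countFin : ∀ {k} → (Fin k → Bool) → ℕ
countFin {zero} f = 0
countFin {suc k} f = (if f zero then 1 else 0) + countFin (λ i → f (suc i))

degree : (G : Graph) → EdgeSet G → Vertex G → ℕ
degree G T v = countFin (λ e → T e ∧ incident G e v)

module Submission where

-- Induction on the number of vertices. A vertex v of degree 2 is a leaf of both trees: delete it. At a vertex v
-- of degree 3, one colour has two edges va, vb and the other one edge vc: replace v by the edge ab; for a
-- suitable one of the edges of the majority colour, that edge and vc may also exchange their colours. When
-- undone, a deletion disturbs the discrepancy of only one neighbour, by one, and by parity this is harmless
-- unless that neighbour is large (of even degree at least 8). So one may assume that the exchangeable edges of
-- small vertices end at large vertices. Two vertices of degree 2 with a common large neighbour can be merged
-- into one. Now delete a vertex of degree 2 at a large vertex u and undo it: only u can get excess 6, which is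
-- then pushed along movers (small vertices with exactly two large neighbours p, q, where the colours of vp, vq
-- can be exchanged in every colouring). If the excess cannot be absorbed, the set R of vertices that it reaches
-- consists of vertices of excess at least 4, which forces many edges from R to non-movers. The union S of such
-- sets contains all large vertices with a neighbour of degree 2, and a discharging argument then contradicts
-- |E| = 2|V| - 2.

open import Defs

open import Data.Nat.Properties using (+-commutativeSemigroup)
open import Algebra.Properties.CommutativeSemigroup +-commutativeSemigroup using (interchange; x∙yz≈y∙xz)
open import Data.Bool using (Bool; true; false; not; if_then_else_; _∧_; _∨_)
open import Data.Bool.Properties using (not-involutive; ∨-identityʳ; ∧-zeroʳ; ∧-identityʳ) renaming (_≟_ to _≟ᵇ_)
open import Data.Empty using (⊥; ⊥-elim)
open import Data.Fin using (Fin; zero; suc)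
import Data.Fin as Fin
open import Data.List using (List; []; _∷_; _++_; map; filter; length; allFin; tabulate)
open import Data.List.Membership.Propositional using (_∈_)
open import Data.List.Membership.Propositional.Properties
  using (∈-map⁺; ∈-map⁻; ∈-∃++; ∈-filter⁺; ∈-filter⁻; ∈-allFin; ∈-tabulate⁺; ∈-tabulate⁻)
open import Data.List.Properties
  using (filter-all; filter-notAll; length-map; length-tabulate; map-tabulate; ∷-injective)
open import Data.List.Relation.Binary.Permutation.Propositional
  using (_↭_; ↭-refl; ↭-prep; ↭-swap; ↭-sym; ↭-trans; ↭-reflexive)
open import Data.List.Relation.Binary.Permutation.Propositional.Properties
  using (map⁺; shift; ∈-resp-↭; drop-∷; ↭-length; ↭-map-inv)
open import Data.List.Relation.Unary.All as All using (All; []; _∷_)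
open import Data.List.Relation.Unary.AllPairs using ([]; _∷_)
open import Data.List.Relation.Unary.Any as Any using (here; there)
open import Data.List.Relation.Unary.Unique.Propositional using (Unique)
import Data.List.Relation.Unary.Unique.Propositional.Properties as Unique
open import Data.Nat hiding (_≟_)
open import Data.Nat using () renaming (_≟_ to _≟ⁿ_)
open import Data.Nat.Divisibility using (_∣_; _∣?_; divides)
open import Data.Nat.ListAction using (sum)
open import Data.Nat.ListAction.Properties using (sum-↭)
open import Data.Nat.Properties hiding (_≟_)
open import Data.Nat.Tactic.RingSolver using (solve-∀)
open import Data.Product using (Σ; _×_; _,_; proj₁; proj₂; ∃-syntax)
open import Data.Sum using (_⊎_; inj₁; inj₂)
open import Function using (_∘_; id)
open import Relation.Binary using (DecidableEquality)
open import Relation.Binary.Construct.Closure.Equivalence as Eq using (EqClosure)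
open import Relation.Binary.Construct.Closure.ReflexiveTransitive using (ε; _◅_; _◅◅_)
open import Relation.Binary.Construct.Closure.Symmetric using (fwd; bwd)
open import Relation.Binary.PropositionalEquality
open import Relation.Nullary using (¬_; Dec; yes; no; does; contradiction)
open import Relation.Nullary.Decidable using (dec-true; dec-false; ¬?; _×-dec_; _⊎-dec_)

-- The constants fit together in the discharging. An edge carries charge 12, so the total is at
-- least 24 below 24|V|. A vertex of degree 2 or 3 is raised to 24 by its large neighbours; this
-- leaves a large vertex 0 on an edge to a vertex of degree 2, 3 on an edge to a mover of degree 3,
-- and at least 4 on any other edge. Discrepancy 6 needs even degree and both colours, so large
-- means degree at least 8, and 8 times 3 is 24: only a neighbour of degree 2 can cause a deficit.
-- Merging limits it to 3 per large vertex, and the edges from `S` to non-movers, on average at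
-- least 4 per vertex of `S`, pay for it. The obstacle is that an excess started at a new vertex may
-- run into the set `S` collected earlier, where its flow is not pursued. So the inequality kept for
-- `S` also counts the movers with just one large end in `S`: each can swallow one later excess
-- edge, and then has both ends in the union.

private variable
  A B : Set

-- Finite sums over lists.

∑ : List A → (A → ℕ) → ℕ
∑ xs f = sum (map f xs)

∑-cong : ∀ (xs : List A) {f g} → (∀ {x} → x ∈ xs → f x ≡ g x) → ∑ xs f ≡ ∑ xs g
∑-cong [] _ = refl
∑-cong (x ∷ xs) h = cong₂ _+_ (h (here refl)) (∑-cong xs (h ∘ there))

∑-mono : ∀ (xs : List A) {f g} → (∀ {x} → x ∈ xs → f x ≤ g x) → ∑ xs f ≤ ∑ xs g
∑-mono [] _ = z≤n
∑-mono (x ∷ xs) h = +-mono-≤ (h (here refl)) (∑-mono xs (h ∘ there))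

∑-+ : ∀ (xs : List A) f g → ∑ xs (λ x → f x + g x) ≡ ∑ xs f + ∑ xs g
∑-+ [] _ _ = refl
∑-+ (x ∷ xs) f g = trans (cong (f x + g x +_) (∑-+ xs f g)) (interchange (f x) (g x) _ _)

∑-*ʳ : ∀ (xs : List A) k f → ∑ xs (λ x → f x * k) ≡ ∑ xs f * k
∑-*ʳ [] k f = refl
∑-*ʳ (x ∷ xs) k f = trans (cong (f x * k +_) (∑-*ʳ xs k f)) (sym (*-distribʳ-+ k (f x) _))

∑-const : ∀ (xs : List A) k → ∑ xs (λ _ → k) ≡ length xs * k
∑-const [] k = refl
∑-const (x ∷ xs) k = cong (k +_) (∑-const xs k)

∑-zero : ∀ (xs : List A) → ∑ xs (λ _ → 0) ≡ 0
∑-zero [] = refl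
∑-zero (x ∷ xs) = ∑-zero xs

∑-swap : ∀ (xs : List A) (ys : List B) (f : A → B → ℕ) →
         ∑ xs (λ x → ∑ ys (f x)) ≡ ∑ ys (λ y → ∑ xs (λ x → f x y))
∑-swap [] ys f = sym (∑-zero ys)
∑-swap (x ∷ xs) ys f =
  trans (cong (∑ ys (f x) +_) (∑-swap xs ys f)) (sym (∑-+ ys (f x) _))

∑-↭ : ∀ {xs ys : List A} (f : A → ℕ) → xs ↭ ys → ∑ xs f ≡ ∑ ys f
∑-↭ f p = sum-↭ (map⁺ f p)

∑-map : ∀ (xs : List A) (h : A → B) (f : B → ℕ) → ∑ (map h xs) f ≡ ∑ xs (f ∘ h)
∑-map [] h f = refl
∑-map (x ∷ xs) h f = cong (f (h x) +_) (∑-map xs h f)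

opaque
  ∈⇒↭ : ∀ {x : A} {xs} → x ∈ xs → ∃[ ys ] (xs ↭ x ∷ ys)
  ∈⇒↭ x∈xs with ys , zs , refl ← ∈-∃++ x∈xs = ys ++ zs , shift _ ys zs

∑-positive : ∀ (xs : List A) f → 1 ≤ ∑ xs f → ∃[ x ] (x ∈ xs × 1 ≤ f x)
∑-positive (x ∷ xs) f h with f x in eq
... | suc _ = x , here refl , subst (1 ≤_) (sym eq) (s≤s z≤n)
... | zero with y , y∈ , fy ← ∑-positive xs f h = y , there y∈ , fy

∑≡0 : ∀ {xs : List A} f → ∑ xs f ≡ 0 → ∀ {x} → x ∈ xs → f x ≡ 0
∑≡0 {xs = x ∷ xs} f h (here refl) = m+n≡0⇒m≡0 (f x) h
∑≡0 {xs = x ∷ xs} f h (there y∈) = ∑≡0 f (m+n≡0⇒n≡0 (f x) h) y∈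

scan : ∀ (xs : List A) {P : A → Set} → (∀ {x} → x ∈ xs → B ⊎ P x) → B ⊎ (∀ {x} → x ∈ xs → P x)
scan [] h = inj₂ λ ()
scan (x ∷ xs) h with h (here refl) | scan xs (h ∘ there)
... | inj₁ b | _ = inj₁ b
... | inj₂ _ | inj₁ b = inj₁ b
... | inj₂ p | inj₂ ps = inj₂ λ { (here refl) → p ; (there i) → ps i }

⟦_⟧ : Bool → ℕ
⟦ b ⟧ = if b then 1 else 0

⟦⟧≤1 : ∀ b → ⟦ b ⟧ ≤ 1
⟦⟧≤1 true = ≤-refl
⟦⟧≤1 false = z≤n

⟦∨⟧ : ∀ a b → ¬ (a ≡ true × b ≡ true) → ⟦ a ∨ b ⟧ ≡ ⟦ a ⟧ + ⟦ b ⟧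
⟦∨⟧ true true h = contradiction (refl , refl) h
⟦∨⟧ true false h = refl
⟦∨⟧ false b h = refl

-- Termination measure for the growth of `R` and for that of `S`: the number of vertices still
-- outside.
count-shrinks : ∀ (xs : List A) {S S′ : A → Bool} {u} → u ∈ xs → (∀ x → S x ≡ true → S′ x ≡ true) →
                S u ≡ false → S′ u ≡ true →
                ∑ xs (λ x → ⟦ not (S′ x) ⟧) < ∑ xs (λ x → ⟦ not (S x) ⟧)
count-shrinks (x ∷ xs) {S} {S′} {u} i inc old new = go i
  where
  monotone : ∀ y → ⟦ not (S′ y) ⟧ ≤ ⟦ not (S y) ⟧
  monotone y with S y in eq
  ... | false = ⟦⟧≤1 (not (S′ y))
  ... | true rewrite inc y eq = z≤n
  go : u ∈ x ∷ xs → ∑ (x ∷ xs) (λ y → ⟦ not (S′ y) ⟧) < ∑ (x ∷ xs) (λ y → ⟦ not (S y) ⟧)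
  go (here refl) = subst₂ (λ a b → ⟦ not a ⟧ + ∑ xs (λ y → ⟦ not (S′ y) ⟧) < ⟦ not b ⟧ + ∑ xs (λ y → ⟦ not (S y) ⟧))
    (sym new) (sym old) (s≤s (∑-mono xs λ {y} _ → monotone y))
  go (there j) = +-mono-≤-< (monotone x) (count-shrinks xs j inc old new)

dec-sound : (d : Dec A) → 1 ≤ ⟦ does d ⟧ → A
dec-sound (yes a) _ = a

dec-complete : (d : Dec A) → A → ⟦ does d ⟧ ≡ 1
dec-complete d a = cong ⟦_⟧ (dec-true d a)

dec-refute : (d : Dec A) → ¬ A → ⟦ does d ⟧ ≡ 0
dec-refute d n = cong ⟦_⟧ (dec-false d n)

-- Two-coloured multigraphs and the connectedness of their colour classes.

module Coloured {V : Set} (_≟_ : DecidableEquality V) where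

  opaque
    hit : V → V → ℕ → ℕ
    hit v a k = if does (v ≟ a) then k else 0

    hit-≡ : ∀ v k → hit v v k ≡ k
    hit-≡ v k rewrite dec-true (v ≟ v) refl = refl

    hit-≢ : ∀ {v a} k → v ≢ a → hit v a k ≡ 0
    hit-≢ {v} {a} k v≢a rewrite dec-false (v ≟ a) v≢a = refl

    hit-mono : ∀ v a {k l} → k ≤ l → hit v a k ≤ hit v a l
    hit-mono v a k≤l with does (v ≟ a)
    ... | true = k≤l
    ... | false = z≤n

    hit-*ʳ : ∀ v a k l → hit v a (k * l) ≡ hit v a k * l
    hit-*ʳ v a k l with does (v ≟ a)
    ... | true = refl
    ... | false = refl

    hit-+ : ∀ v a k l → hit v a (k + l) ≡ hit v a k + hit v a l
    hit-+ v a k l with does (v ≟ a)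
    ... | true = refl
    ... | false = refl

  ∑-hit : ∀ {vs a} → Unique vs → a ∈ vs → (k : V → ℕ) → ∑ vs (λ v → hit v a (k v)) ≡ k a
  ∑-hit {v ∷ vs} {a} (v∉ ∷ un) (here refl) k =
    trans (cong₂ _+_ (hit-≡ v (k v)) (trans (∑-cong vs λ {w} w∈ → hit-≢ (k w) λ { refl → All.lookup v∉ w∈ refl }) (∑-zero vs)))
          (+-identityʳ (k v))
  ∑-hit {v ∷ vs} {a} (v∉ ∷ un) (there a∈) k =
    cong₂ _+_ (hit-≢ (k v) (All.lookup v∉ a∈)) (∑-hit un a∈ k)

  Coloured : Set
  Coloured = List (Bool × V × V)

  -- A loop at v is counted twice.
  term : (Bool → V → ℕ) → V → Bool × V × V → ℕ
  term g v (c , a , b) = hit v a (g c b) + hit v b (g c a)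

  opaque
    -- Degrees, colour degrees, numbers of large neighbours and charges are all instances of this
    -- sum over the edges at `v`, with `g` applied to the colour and the far end. Its uncoloured
    -- form `usum` is the same for all colourings of a graph.
    nbs : Coloured → V → (Bool → V → ℕ) → ℕ
    nbs T v g = ∑ T (term g v)

    usum : List (V × V) → V → (V → ℕ) → ℕ
    usum es v g = ∑ es (λ (a , b) → hit v a (g b) + hit v b (g a))

    nbs-∑ : ∀ T v g → nbs T v g ≡ ∑ T (term g v)
    nbs-∑ T v g = refl

    nbs-[] : ∀ v g → nbs [] v g ≡ 0
    nbs-[] v g = refl

    nbs-∷ : ∀ e T v g → nbs (e ∷ T) v g ≡ term g v e + nbs T v g
    nbs-∷ e T v g = refl

    nbs-↭ : ∀ {T T′} v g → T ↭ T′ → nbs T v g ≡ nbs T′ v g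
    nbs-↭ v g p = ∑-↭ (term g v) p

    usum-↭ : ∀ {es es′} v g → es ↭ es′ → usum es v g ≡ usum es′ v g
    usum-↭ v g p = ∑-↭ _ p

    nbs-uncoloured : ∀ T v g → nbs T v (λ _ → g) ≡ usum (map proj₂ T) v g
    nbs-uncoloured T v g = sym (∑-map T proj₂ _)

  opaque
    unfolding nbs

    nbs-mono : ∀ T v {f g} → (∀ c o → f c o ≤ g c o) → nbs T v f ≤ nbs T v g
    nbs-mono T v h = ∑-mono T λ {e} _ → +-mono-≤ (hit-mono v _ (h _ _)) (hit-mono v _ (h _ _))

    nbs-cong : ∀ T v {f g} → (∀ c o → f c o ≡ g c o) → nbs T v f ≡ nbs T v g
    nbs-cong T v h = ∑-cong T λ {e} _ → cong₂ _+_ (cong (hit v _) (h _ _)) (cong (hit v _) (h _ _))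

    nbs-+ : ∀ T v f g → nbs T v (λ c o → f c o + g c o) ≡ nbs T v f + nbs T v g
    nbs-+ T v f g = trans (∑-cong T λ {e} _ → split e) (∑-+ T (term f v) (term g v))
      where
      split : ∀ e → term (λ c o → f c o + g c o) v e ≡ term f v e + term g v e
      split (c , a , b) = trans (cong₂ _+_ (hit-+ v a _ _) (hit-+ v b _ _)) (interchange (hit v a (f c b)) _ _ _)

  opaque
    unfolding nbs

    nbs-*ʳ : ∀ T v g k → nbs T v (λ c o → g c o * k) ≡ nbs T v g * k
    nbs-*ʳ T v g k = trans (∑-cong T λ {e} _ → factor e) (∑-*ʳ T k (term g v))
      where
      factor : ∀ e → term (λ c o → g c o * k) v e ≡ term g v e * k
      factor (c , a , b) = trans (cong₂ _+_ (hit-*ʳ v a _ k) (hit-*ʳ v b _ k)) (sym (*-distribʳ-+ k (hit v a (g c b)) _))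

  nbs-zero : ∀ T v {g} → (∀ c o → g c o ≡ 0) → nbs T v g ≡ 0
  nbs-zero T v h = trans (nbs-cong T v λ c o → trans (h c o) (sym (*-zeroʳ 1))) (trans (nbs-*ʳ T v (λ _ _ → 1) 0) (*-zeroʳ (nbs T v (λ _ _ → 1))))

  Ends : List V → List (V × V) → Set
  Ends vs es = ∀ {a b} → (a , b) ∈ es → a ∈ vs × b ∈ vs

  double-count : ∀ {vs} T → Unique vs → Ends vs (map proj₂ T) → (f : V → Bool → V → ℕ) →
                 ∑ vs (λ v → nbs T v (f v)) ≡ ∑ T (λ (c , a , b) → f a c b + f b c a)
  double-count {vs} T un ends f =
    trans (∑-cong vs λ {v} _ → nbs-∑ T v (f v)) (trans (∑-swap vs T (λ v → term (f v) v)) (∑-cong T λ {e} e∈ → both e (ends (∈-map⁺ proj₂ e∈))))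
    where
    both : ∀ e → proj₁ (proj₂ e) ∈ vs × proj₂ (proj₂ e) ∈ vs →
           ∑ vs (λ v → term (f v) v e) ≡ f (proj₁ (proj₂ e)) (proj₁ e) (proj₂ (proj₂ e)) + f (proj₂ (proj₂ e)) (proj₁ e) (proj₁ (proj₂ e))
    both (c , a , b) (a∈ , b∈) =
      trans (∑-+ vs (λ v → hit v a (f v c b)) (λ v → hit v b (f v c a)))
            (cong₂ _+_ (∑-hit un a∈ (λ v → f v c b)) (∑-hit un b∈ (λ v → f v c a)))

  -- The orientation of a stored pair has no meaning. `proper` guarantees that `u` survives when `v`
  -- is deleted.
  record Link (e : V × V) (v u : V) : Set where
    constructor link
    field
      either : e ≡ (v , u) ⊎ e ≡ (u , v)
      proper : u ≢ v
  open Link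

  link-sym : ∀ {e v u} → Link e v u → Link e u v
  link-sym (link (inj₁ p) n) = link (inj₂ p) (n ∘ sym)
  link-sym (link (inj₂ p) n) = link (inj₁ p) (n ∘ sym)

  term-self : ∀ {e v u} g c → Link e v u → term g v (c , e) ≡ g c u
  term-self {v = v} {u} g c (link (inj₁ refl) n) =
    trans (cong₂ _+_ (hit-≡ v _) (hit-≢ _ (n ∘ sym))) (+-identityʳ _)
  term-self {v = v} {u} g c (link (inj₂ refl) n) = cong₂ _+_ (hit-≢ _ (n ∘ sym)) (hit-≡ v _)

  term-other : ∀ {e v u z} g c → Link e v u → z ≢ v → term g z (c , e) ≡ hit z u (g c v)
  term-other {u = u} {z} g c (link (inj₁ refl) n) z≢v = cong (_+ hit z u (g c _)) (hit-≢ _ z≢v)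
  term-other {u = u} {z} g c (link (inj₂ refl) n) z≢v = trans (cong (hit z u (g c _) +_) (hit-≢ _ z≢v)) (+-identityʳ _)

  Con : Coloured → Bool → V → V → Set
  Con T c = EqClosure (λ a b → (c , a , b) ∈ T)

  con-sym : ∀ {T c a b} → Con T c a b → Con T c b a
  con-sym = Eq.symmetric _

  con-map : ∀ {T T′ c} (f : V → V) → (∀ {a b} → (c , a , b) ∈ T → Con T′ c (f a) (f b)) →
            ∀ {a b} → Con T c a b → Con T′ c (f a) (f b)
  con-map f h = Eq.gfold (Eq.isEquivalence _) f h

  con-⊆ : ∀ {T T′ c} → (∀ {a b} → (c , a , b) ∈ T → Con T′ c a b) → ∀ {a b} → Con T c a b → Con T′ c a b
  con-⊆ = con-map id

  edge : ∀ {T c a b} → (c , a , b) ∈ T → Con T c a b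
  edge i = Eq.return i

  con-link : ∀ {T c e v u} → Link e v u → (c , e) ∈ T → Con T c v u
  con-link (link (inj₁ refl) _) i = edge i
  con-link (link (inj₂ refl) _) i = con-sym (edge i)

  Spans : List V → Coloured → Bool → Set
  Spans vs T c = ∀ {a b} → a ∈ vs → b ∈ vs → Con T c a b

  Spanning : List V → Coloured → Set
  Spanning vs T = ∀ c → Spans vs T c

  spanning-↭ : ∀ {vs T T′} → T ↭ T′ → Spanning vs T → Spanning vs T′
  spanning-↭ p s c a∈ b∈ = con-⊆ (edge ∘ ∈-resp-↭ p) (s c a∈ b∈)

  opaque
    leaving-edge : ∀ {T c x w} → Con T c x w → w ≢ x → ∃[ e ] ∃[ u ] ((c , e) ∈ T × Link e x u)
    leaving-edge ε w≢x = contradiction refl w≢x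
    leaving-edge {x = x} (_◅_ {j = y} s p) w≢x with y ≟ x
    -- A loop at `x` is skipped, since `Link` asks for a proper edge.
    ... | yes refl = leaving-edge p w≢x
    leaving-edge (fwd i ◅ p) w≢x | no y≢x = _ , _ , i , link (inj₁ refl) y≢x
    leaving-edge (bwd i ◅ p) w≢x | no y≢x = _ , _ , i , link (inj₂ refl) y≢x

  infixl 6 _∖_
  _∖_ : List V → V → List V
  vs ∖ x = filter (λ v → ¬? (v ≟ x)) vs

  ∈-∖⁺ : ∀ {vs x v} → v ∈ vs → v ≢ x → v ∈ vs ∖ x
  ∈-∖⁺ = ∈-filter⁺ _

  ∈-∖⁻ : ∀ {vs x v} → v ∈ vs ∖ x → v ∈ vs × v ≢ x
  ∈-∖⁻ {vs} {x} = ∈-filter⁻ (λ v → ¬? (v ≟ x)) {xs = vs}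

  unique-∖ : ∀ {vs x} → Unique vs → Unique (vs ∖ x)
  unique-∖ = Unique.filter⁺ _

  length-∖ : ∀ {vs x} → Unique vs → x ∈ vs → length vs ≡ suc (length (vs ∖ x))
  length-∖ {v ∷ vs} {x} (v∉ ∷ un) i with v ≟ x | i
  ... | yes refl | _ = cong (suc ∘ length) (sym (filter-all _ (All.map (λ n → n ∘ sym) v∉)))
  ... | no v≢x | here refl = contradiction refl v≢x
  ... | no v≢x | there j = cong suc (length-∖ un j)

  redirect : V → V → V → V
  redirect x u v = if does (v ≟ x) then u else v

  redirect-≡ : ∀ x u → redirect x u x ≡ u
  redirect-≡ x u rewrite dec-true (x ≟ x) refl = refl

  redirect-≢ : ∀ {x v} u → v ≢ x → redirect x u v ≡ v
  redirect-≢ {x} {v} u v≢x rewrite dec-false (v ≟ x) v≢x = refl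

  Free : V → Coloured → Set
  Free x T = ∀ {c a b} → (c , a , b) ∈ T → a ≢ x × b ≢ x

  -- Deleting x preserves connectedness if every edge at x, redirected to u, is bridged in T′.
  delete : ∀ {vs T T′ c x} u →
           (∀ {p q} → (c , p , q) ∈ T →
             (∃[ y ] (Link (p , q) x y × Con T′ c u y)) ⊎ ((p ≢ x × q ≢ x) × Con T′ c p q)) →
           Spans vs T c → Spans (vs ∖ x) T′ c
  delete {vs} {T} {T′} {c} {x} u h s a∈ b∈ with ∈-∖⁻ {vs} a∈ | ∈-∖⁻ {vs} b∈
  ... | a∈vs , a≢x | b∈vs , b≢x =
    subst₂ (Con T′ c) (redirect-≢ u a≢x) (redirect-≢ u b≢x) (con-map (redirect x u) move (s a∈vs b∈vs))
    where
    move : ∀ {p q} → (c , p , q) ∈ T → Con T′ c (redirect x u p) (redirect x u q)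
    move i with h i
    ... | inj₂ ((p≢ , q≢) , k) = subst₂ (Con T′ c) (sym (redirect-≢ u p≢)) (sym (redirect-≢ u q≢)) k
    ... | inj₁ (y , link (inj₁ refl) y≢ , k) = subst₂ (Con T′ c) (sym (redirect-≡ x u)) (sym (redirect-≢ u y≢)) k
    ... | inj₁ (y , link (inj₂ refl) y≢ , k) = subst₂ (Con T′ c) (sym (redirect-≢ u y≢)) (sym (redirect-≡ x u)) (con-sym k)

  attach : ∀ {vs T T′ c x u} → (∀ {p q} → (c , p , q) ∈ T′ → Con T c p q) → u ∈ vs ∖ x → Con T c x u →
           Spans (vs ∖ x) T′ c → Spans vs T c
  attach {vs} {T} {T′} {c} {x} {u} h u∈ k s {a} {b} a∈ b∈ = from a∈ ◅◅ con-sym (from b∈)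
    where
    from : ∀ {a} → a ∈ vs → Con T c a u
    from {a} a∈ with a ≟ x
    ... | yes refl = k
    ... | no a≢x = con-⊆ h (s (∈-∖⁺ a∈ a≢x) u∈)

  colour-cases : ∀ c k → k ≡ c ⊎ k ≡ not c
  colour-cases true true = inj₁ refl
  colour-cases true false = inj₂ refl
  colour-cases false true = inj₂ refl
  colour-cases false false = inj₁ refl

  c≢not : ∀ {c} → c ≢ not c
  c≢not {true} ()
  c≢not {false} ()

  opposite-leaves : Bool → V × V → V × V → Coloured → Coloured
  opposite-leaves c e₁ e₂ T = (c , e₁) ∷ (not c , e₂) ∷ T

  opposite-swap : ∀ {T c e₁ e₂ T′} → T ↭ opposite-leaves c e₁ e₂ T′ → T ↭ opposite-leaves (not c) e₂ e₁ T′
  opposite-swap {T} {c} {e₁} {e₂} {T′} p =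
    subst (λ k → T ↭ (not c , e₂) ∷ (k , e₁) ∷ T′) (sym (not-involutive c)) (↭-trans p (↭-swap _ _ ↭-refl))

  delete₂ : ∀ {vs T c x e₁ u e₂ y} → Link e₁ x u → Link e₂ x y → Free x T →
            Spanning vs (opposite-leaves c e₁ e₂ T) → Spanning (vs ∖ x) T
  delete₂ {c = c} {u = u} {y = y} l₁ l₂ free s k with colour-cases c k
  ... | inj₁ refl = delete u (λ { (here refl) → inj₁ (_ , l₁ , ε)
                                ; (there (here eq)) → contradiction (cong proj₁ eq) c≢not
                                ; (there (there i)) → inj₂ (free i , edge i) }) (s c)
  ... | inj₂ refl = delete y (λ { (here eq) → contradiction (sym (cong proj₁ eq)) c≢not
                                ; (there (here refl)) → inj₁ (_ , l₂ , ε)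
                                ; (there (there i)) → inj₂ (free i , edge i) }) (s (not c))

  attach₂ : ∀ {vs T c x e₁ u e₂ y} → Link e₁ x u → Link e₂ x y → u ∈ vs → y ∈ vs →
            Spanning (vs ∖ x) T → Spanning vs (opposite-leaves c e₁ e₂ T)
  attach₂ {c = c} l₁ l₂ u∈ y∈ s k with colour-cases c k
  ... | inj₁ refl = attach (λ i → edge (there (there i))) (∈-∖⁺ u∈ (proper l₁)) (con-link l₁ (here refl)) (s c)
  ... | inj₂ refl = attach (λ i → edge (there (there i))) (∈-∖⁺ y∈ (proper l₂)) (con-link l₂ (there (here refl))) (s (not c))

  module _ {vs : List V} {T : Coloured} {c : Bool} {x : V} {e₁ : V × V} {a : V} {e₂ : V × V} {d : V} {e₃ : V × V} {b : V}
    (l₁ : Link e₁ x a) (l₂ : Link e₂ x d) (l₃ : Link e₃ x b) where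

    private
      T₃ : Coloured
      T₃ = (c , e₁) ∷ (c , e₂) ∷ (not c , e₃) ∷ T

    -- Class `c` only needs the new edge to restore the connection between `a` and `d`; it need not
    -- join these two. The exchange of colours applies this with an edge from `a` to `b`.
    delete₃ : Free x T → ∀ {a′ d′} → Con ((c , a′ , d′) ∷ T) c a d → Spanning vs T₃ → Spanning (vs ∖ x) ((c , a′ , d′) ∷ T)
    delete₃ free j s k with colour-cases c k
    ... | inj₁ refl = delete a (λ { (here refl) → inj₁ (_ , l₁ , ε)
                                  ; (there (here refl)) → inj₁ (_ , l₂ , j)
                                  ; (there (there (here eq))) → contradiction (cong proj₁ eq) c≢not
                                  ; (there (there (there i))) → inj₂ (free i , edge (there i)) }) (s c)
    ... | inj₂ refl = delete b (λ { (here eq) → contradiction (sym (cong proj₁ eq)) c≢not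
                                  ; (there (here eq)) → contradiction (sym (cong proj₁ eq)) c≢not
                                  ; (there (there (here refl))) → inj₁ (_ , l₃ , ε)
                                  ; (there (there (there i))) → inj₂ (free i , edge (there i)) }) (s (not c))

    -- In colour `c` the edge `ad` is subdivided by `x`; in the other colour `x` is a leaf at `b`.
    attach₃ : a ∈ vs → b ∈ vs → Spanning (vs ∖ x) ((c , a , d) ∷ T) → Spanning vs T₃
    attach₃ a∈ b∈ s k with colour-cases c k
    ... | inj₁ refl = attach (λ { (here refl) → con-sym (con-link l₁ (here refl)) ◅◅ con-link l₂ (there (here refl))
                                ; (there i) → edge (there (there (there i))) })
                             (∈-∖⁺ a∈ (proper l₁)) (con-link l₁ (here refl)) (s c)
    ... | inj₂ refl = attach (λ { (here eq) → contradiction (sym (cong proj₁ eq)) c≢not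
                                ; (there i) → edge (there (there (there i))) })
                             (∈-∖⁺ b∈ (proper l₃)) (con-link l₃ (there (there (here refl)))) (s (not c))

    opaque
      -- A walk of colour `c` from `b` first reaches `x` along `e₁` or `e₂`, and its part before
      -- that avoids `x`. The answer decides which of these two edges can trade colours with `e₃`.
      side : Free x T → Spanning vs T₃ → x ∈ vs → b ∈ vs → Con T c b a ⊎ Con T c b d
      side free s x∈ b∈ with walk (s c b∈ x∈)
        where
        Side : V → Set
        Side w = w ≡ x ⊎ Con T c w a ⊎ Con T c w d
        at-x : ∀ {e u w w′} → Link e x u → (w , w′) ≡ e ⊎ (w′ , w) ≡ e → Con T c u a ⊎ Con T c u d → Side w
        at-x (link (inj₁ refl) _) (inj₁ refl) k = inj₁ refl
        at-x (link (inj₂ refl) _) (inj₁ refl) k = inj₂ k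
        at-x (link (inj₁ refl) _) (inj₂ refl) k = inj₂ k
        at-x (link (inj₂ refl) _) (inj₂ refl) k = inj₁ refl
        extend : ∀ {w w′} → w′ ≢ x → Con T c w w′ → Side w′ → Side w
        extend n k (inj₁ eq) = contradiction eq n
        extend n k (inj₂ (inj₁ k′)) = inj₂ (inj₁ (k ◅◅ k′))
        extend n k (inj₂ (inj₂ k′)) = inj₂ (inj₂ (k ◅◅ k′))
        walk : ∀ {w} → Con T₃ c w x → Side w
        walk ε = inj₁ refl
        walk (fwd (here refl) ◅ _) = at-x l₁ (inj₁ refl) (inj₁ ε)
        walk (bwd (here refl) ◅ _) = at-x l₁ (inj₂ refl) (inj₁ ε)
        walk (fwd (there (here refl)) ◅ _) = at-x l₂ (inj₁ refl) (inj₂ ε)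
        walk (bwd (there (here refl)) ◅ _) = at-x l₂ (inj₂ refl) (inj₂ ε)
        walk (fwd (there (there (here eq))) ◅ _) = contradiction (cong proj₁ eq) c≢not
        walk (bwd (there (there (here eq))) ◅ _) = contradiction (cong proj₁ eq) c≢not
        walk (fwd (there (there (there i))) ◅ p) = extend (proj₂ (free i)) (edge i) (walk p)
        walk (bwd (there (there (there i))) ◅ p) = extend (proj₁ (free i)) (con-sym (edge i)) (walk p)
      ... | inj₁ refl = contradiction refl (proper l₃)
      ... | inj₂ k = k

  one : Bool → V → ℕ
  one _ _ = 1

  degree-zero : ∀ {T x} → nbs T x one ≡ 0 → Free x T
  degree-zero {T} {x} h {c} {a} {b} i = not-a , not-b
    where
    z : hit x a 1 + hit x b 1 ≡ 0
    z = ∑≡0 (term one x) (trans (sym (nbs-∑ T x one)) h) i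
    not-a : a ≢ x
    not-a refl with () ← trans (sym (hit-≡ x 1)) (m+n≡0⇒m≡0 (hit x a 1) z)
    not-b : b ≢ x
    not-b refl with () ← trans (sym (hit-≡ x 1)) (m+n≡0⇒n≡0 (hit x a 1) z)

  opaque
    unfolding hit

    hit-positive : ∀ {v a k} → 1 ≤ hit v a k → v ≡ a × 1 ≤ k
    hit-positive {v} {a} h with v ≟ a
    ... | yes refl = refl , h

  positive-summand : ∀ a {b} → 1 ≤ a + b → 1 ≤ a ⊎ 1 ≤ b
  positive-summand zero h = inj₂ h
  positive-summand (suc a) h = inj₁ (s≤s z≤n)

  opaque
    nbs-positive : ∀ T x g → 1 ≤ nbs T x g → ∃[ c ] ∃[ e ] ∃[ u ] ((c , e) ∈ T × (e ≡ (x , u) ⊎ e ≡ (u , x)) × 1 ≤ g c u)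
    nbs-positive T x g h with ∑-positive T (term g x) (subst (1 ≤_) (nbs-∑ T x g) h)
    ... | (c , a , b) , i , pos with positive-summand (hit x a (g c b)) pos
    ... | inj₁ pos₁ with refl , k ← hit-positive pos₁ = c , _ , b , i , inj₁ refl , k
    ... | inj₂ pos₂ with refl , k ← hit-positive pos₂ = c , _ , a , i , inj₂ refl , k

  opaque
    degree-one : ∀ {T x} → nbs T x one ≡ 1 → ∃[ c ] ∃[ e ] ∃[ u ] ∃[ T′ ] (T ↭ (c , e) ∷ T′ × Link e x u × Free x T′)
    degree-one {T} {x} h with nbs-positive T x one (≤-reflexive (sym h))
    ... | c , e , u , i , l , _ with ∈⇒↭ i
    ... | T′ , p = c , e , u , T′ , p , ln , degree-zero (suc-injective (trans (cong (_+ nbs T′ x one) (sym (term-self one c ln))) total))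
      where
      total : term one x (c , e) + nbs T′ x one ≡ 1
      total = trans (sym (trans (nbs-↭ x one p) (nbs-∷ (c , e) T′ x one))) h
      -- A loop counts twice, so it would already give degree 2.
      loop : e ≡ (x , u) ⊎ e ≡ (u , x) → u ≢ x
      loop (inj₁ refl) refl with () ← subst (λ k → k + k + nbs T′ x one ≡ 1) (hit-≡ x 1) total
      loop (inj₂ refl) refl with () ← subst (λ k → k + k + nbs T′ x one ≡ 1) (hit-≡ x 1) total
      ln : Link e x u
      ln = link l (loop l)

  module _ {vs : List V} {T : Coloured} {x w : V} (s : Spanning vs T) (x∈ : x ∈ vs) (w∈ : w ∈ vs) (w≢x : w ≢ x) where

    opaque
      -- As `x` is not the only vertex, the other colour class must leave `x` as well.
      degree-from-link : ∀ {c e u T′} → T ↭ (c , e) ∷ T′ → Link e x u →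
        ∃[ e′ ] ∃[ y ] ∃[ T″ ] (T ↭ opposite-leaves c e e′ T″ × Link e′ x y × nbs T x one ≡ 2 + nbs T″ x one)
      degree-from-link {c} {e} {u} {T′} p l with leaving-edge (s (not c) x∈ w∈) w≢x
      ... | e′ , y , i , l′ with ∈-resp-↭ p i
      ... | here eq = contradiction (sym (cong proj₁ eq)) c≢not
      ... | there j with ∈⇒↭ j
      ... | T″ , q = e′ , y , T″ , pq , l′ ,
                     trans (nbs-↭ x one pq) (trans (nbs-∷ _ _ x one) (cong₂ _+_ (term-self one c l) (trans (nbs-∷ _ T″ x one) (cong (_+ nbs T″ x one) (term-self one (not c) l′)))))
        where
        pq : T ↭ opposite-leaves c e e′ T″
        pq = ↭-trans p (↭-prep _ q)

    opaque
      opposite-edges : ∃[ e ] ∃[ u ] ∃[ e′ ] ∃[ y ] ∃[ T″ ]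
        (T ↭ opposite-leaves true e e′ T″ × Link e x u × Link e′ x y × nbs T x one ≡ 2 + nbs T″ x one)
      opposite-edges with leaving-edge (s true x∈ w∈) w≢x
      ... | e , u , i , l with ∈⇒↭ i
      ... | T′ , p with degree-from-link p l
      ... | e′ , y , T″ , q , l′ , n = e , u , e′ , y , T″ , q , l , l′ , n

    opaque
      degree-two-at : ∀ {c e u} → nbs T x one ≡ 2 → (c , e) ∈ T → Link e x u →
        ∃[ e′ ] ∃[ y ] ∃[ T″ ] (T ↭ opposite-leaves c e e′ T″ × Link e′ x y × Free x T″)
      degree-two-at d i l with ∈⇒↭ i
      ... | T′ , p with degree-from-link p l
      ... | e′ , y , T″ , q , l′ , n = e′ , y , T″ , q , l′ , degree-zero (suc-injective (suc-injective (trans (sym n) d)))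

    opaque
      -- Each colour occurs at `x`, and the third edge repeats one of them; `c` is the majority
      -- colour.
      degree-three : nbs T x one ≡ 3 →
        ∃[ c ] ∃[ e₁ ] ∃[ a ] ∃[ e₂ ] ∃[ d ] ∃[ e₃ ] ∃[ b ] ∃[ T′ ]
        (T ↭ (c , e₁) ∷ (c , e₂) ∷ (not c , e₃) ∷ T′ × Link e₁ x a × Link e₂ x d × Link e₃ x b × Free x T′)
      degree-three d =
        let e , u , e′ , y , T″ , q , l , l′ , n = opposite-edges
            c , e″ , z , T‴ , r , l″ , free = degree-one {T″} {x} (suc-injective (suc-injective (trans (sym n) d)))
        in third c q r l l′ l″ free
        where
        third : ∀ c {e u e′ y e″ z T″ T‴} → T ↭ opposite-leaves true e e′ T″ → T″ ↭ (c , e″) ∷ T‴ →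
          Link e x u → Link e′ x y → Link e″ x z → Free x T‴ →
          ∃[ c ] ∃[ e₁ ] ∃[ a ] ∃[ e₂ ] ∃[ d ] ∃[ e₃ ] ∃[ b ] ∃[ T′ ]
          (T ↭ (c , e₁) ∷ (c , e₂) ∷ (not c , e₃) ∷ T′ × Link e₁ x a × Link e₂ x d × Link e₃ x b × Free x T′)
        third true q r l l′ l″ free = true , _ , _ , _ , _ , _ , _ , _ ,
          ↭-trans q (↭-prep _ (↭-trans (↭-prep _ r) (↭-swap _ _ ↭-refl))) , l , l″ , l′ , free
        third false q r l l′ l″ free = false , _ , _ , _ , _ , _ , _ , _ ,
          ↭-trans q (↭-trans (↭-swap _ _ r) (↭-prep _ (↭-swap _ _ ↭-refl))) , l′ , l″ , l , free

-- Balanced colourings and the reductions at vertices of degree 2 and 3.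

δ : Bool → Bool → ℕ
δ true b = ⟦ b ⟧
δ false b = ⟦ not b ⟧

δ≤1 : ∀ c k → δ c k ≤ 1
δ≤1 true k = ⟦⟧≤1 k
δ≤1 false k = ⟦⟧≤1 (not k)

δ-same : ∀ c → δ c c ≡ 1
δ-same true = refl
δ-same false = refl

δ-opposite : ∀ c → δ c (not c) ≡ 0
δ-opposite true = refl
δ-opposite false = refl

δ-sumˡ : ∀ c k → δ c k + δ (not c) k ≡ 1
δ-sumˡ true true = refl
δ-sumˡ true false = refl
δ-sumˡ false true = refl
δ-sumˡ false false = refl

δ-sumʳ : ∀ c k → δ c k + δ c (not k) ≡ 1
δ-sumʳ true true = refl
δ-sumʳ true false = refl
δ-sumʳ false true = refl
δ-sumʳ false false = refl

opaque
  -- The additional edge takes the colour that is rarer so far, which is `not k`.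
  favour : ∀ (f : Bool → ℕ) → (∀ c → f c ≤ 5 + f (not c)) →
           ∃[ k ] (∀ c → δ c (not k) + f c ≤ 5 + (δ (not c) (not k) + f (not c)))
  favour f h with ≤-total (f true) (f false)
  ... | inj₁ t≤f = false , λ { true → s≤s (≤-trans t≤f (m≤n+m _ 4))
                             ; false → ≤-trans (h false) (+-monoʳ-≤ 5 (n≤1+n _)) }
  ... | inj₂ f≤t = true , λ { true → ≤-trans (h true) (+-monoʳ-≤ 5 (n≤1+n _))
                            ; false → s≤s (≤-trans f≤t (m≤n+m _ 4)) }

module Reductions {V : Set} (_≟_ : DecidableEquality V) where

  open Coloured _≟_
  open Link

  -- Acyclicity is not recorded: two connected classes with at most 2|V| - 2 edges in all are
  -- automatically trees. Edges have no identity here, only a multiset of pairs is kept, so parallel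
  -- edges are interchangeable.
  record Colouring (vs : List V) (es : List (V × V)) (T : Coloured) : Set where
    constructor colouring
    field
      edges : map proj₂ T ↭ es
      spans : Spanning vs T
  open Colouring

  record WellFormed (vs : List V) (es : List (V × V)) : Set where
    constructor wellFormed
    field
      unique : Unique vs
      ends : Ends vs es
      size : length es + 2 ≤ 2 * length vs
  open WellFormed

  cdeg : Coloured → Bool → V → ℕ
  cdeg T c v = nbs T v (λ k _ → δ c k)

  Near : ℕ → Coloured → V → Set
  Near k T v = ∀ c → cdeg T c v ≤ k + cdeg T (not c) v

  Balanceable : List V → List (V × V) → Set
  Balanceable vs es = ∃[ T ] (Colouring vs es T × ∀ v → Near 5 T v)

  near-cong : ∀ {k T T′ v} → (∀ c → cdeg T c v ≡ cdeg T′ c v) → Near k T′ v → Near k T v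
  near-cong {k} eq h c = subst₂ (λ a b → a ≤ k + b) (sym (eq c)) (sym (eq (not c))) (h c)

  near-weaken : ∀ {k T v} → Near k T v → Near (suc k) T v
  near-weaken h c = m≤n⇒m≤1+n (h c)

  shift-near : ∀ {k f g a b} → f ≤ k + g → a ≤ 1 → a + f ≤ suc k + (b + g)
  shift-near {k} {f} {g} {a} {b} h a≤1 = begin
    a + f             ≤⟨ +-mono-≤ a≤1 h ⟩
    suc (k + g)       ≤⟨ s≤s (+-monoʳ-≤ k (m≤n+m g b)) ⟩
    suc k + (b + g)   ∎
    where open ≤-Reasoning

  -- `other` expresses that there are at least two vertices; this is what makes both colours occur
  -- at every vertex.
  module Instance {vs : List V} {es : List (V × V)} (wf : WellFormed vs es)
    (other : ∀ x → ∃[ w ] (w ∈ vs × w ≢ x))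
    (ih : ∀ {vs′ es′} → length vs′ < length vs → WellFormed vs′ es′ → ∃[ T ] Colouring vs′ es′ T → Balanceable vs′ es′)
    where

    deg : V → ℕ
    deg v = usum es v (λ _ → 1)

    Large : V → Set
    Large v = 8 ≤ deg v × 2 ∣ deg v

    large? : ∀ v → Dec (Large v)
    large? v = (8 ≤? deg v) ×-dec (2 ∣? deg v)

    nbs≡usum : ∀ {T} → Colouring vs es T → ∀ v g → nbs T v (λ _ → g) ≡ usum es v g
    nbs≡usum {T} C v g = trans (nbs-uncoloured T v g) (usum-↭ v g (edges C))

    cdeg-sum : ∀ {T} → Colouring vs es T → ∀ c v → cdeg T c v + cdeg T (not c) v ≡ deg v
    cdeg-sum {T} C c v = trans (sym (nbs-+ T v _ _)) (trans (nbs-cong T v λ k _ → δ-sumˡ c k) (nbs≡usum C v _))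

    low-degree : ∀ {T v} → Colouring vs es T → deg v ≤ 5 → Near 5 T v
    low-degree {T} {v} C h c = ≤-trans (m+n≤o⇒m≤o _ (≤-reflexive (cdeg-sum C c v))) (≤-trans h (m≤m+n 5 _))

    colour-present : ∀ {T v} → Colouring vs es T → v ∈ vs → ∀ c → 1 ≤ cdeg T c v
    colour-present {T} {v} C v∈ c with other v
    ... | w , w∈ , w≢v with leaving-edge (spans C c v∈ w∈) w≢v
    ... | e , u , i , l with ∈⇒↭ i
    ... | T′ , p = ≤-trans (≤-reflexive (sym (trans (term-self (λ k _ → δ c k) c l) (δ-same c))))
                           (≤-trans (m≤m+n _ _) (≤-reflexive (sym (trans (nbs-↭ v _ p) (nbs-∷ _ T′ v _)))))

    even-lemma : ∀ g → 2 ∣ ((6 + g) + g)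
    even-lemma g = divides (3 + g) (arith g)
      where
      arith : ∀ g → (6 + g) + g ≡ (3 + g) * 2
      arith = solve-∀

    odd-lemma : ∀ g → ¬ 2 ∣ ((5 + g) + g)
    odd-lemma g (divides q eq) = go q (2 + g) (trans (sym eq) (arith g))
      where
      arith : ∀ g → (5 + g) + g ≡ suc ((2 + g) * 2)
      arith = solve-∀
      go : ∀ a b → a * 2 ≢ suc (b * 2)
      go zero b ()
      go (suc zero) zero ()
      go (suc (suc a)) zero ()
      go (suc a) (suc b) h = go a b (suc-injective (suc-injective h))

    -- Discrepancy 6 means even degree, and both colours occur at v, so the degree is at least 8.
    not-large : ∀ {T v} → Colouring vs es T → v ∈ vs → ¬ Large v → Near 6 T v → Near 5 T v
    not-large {T} {v} C v∈ small h c with m≤n⇒m<n∨m≡n (h c)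
    ... | inj₁ (s≤s lt) = lt
    ... | inj₂ eq = contradiction (subst (8 ≤_) total big , subst (2 ∣_) total (even-lemma g)) small
      where
      g = cdeg T (not c) v
      total : (6 + g) + g ≡ deg v
      total = trans (cong (_+ g) (sym eq)) (cdeg-sum C c v)
      big : 8 ≤ (6 + g) + g
      big = +-mono-≤ (+-monoʳ-≤ 6 (≤-trans (colour-present C v∈ (not c)) ≤-refl)) (colour-present C v∈ (not c))

    -- The two colour degrees have an even sum, so they cannot differ by exactly 5.
    large-even : ∀ {T v} → Colouring vs es T → Large v → Near 5 T v → Near 4 T v
    large-even {T} {v} C (_ , even) h c with m≤n⇒m<n∨m≡n (h c)
    ... | inj₁ (s≤s lt) = lt
    ... | inj₂ eq = contradiction (subst (2 ∣_) (trans (sym (cdeg-sum C c v)) (cong (_+ cdeg T (not c) v) eq)) even) (odd-lemma (cdeg T (not c) v))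

    in-es : ∀ {T c e} → Colouring vs es T → (c , e) ∈ T → e ∈ es
    in-es C i = ∈-resp-↭ (edges C) (∈-map⁺ proj₂ i)

    link-end : ∀ {e v u} → e ∈ es → Link e v u → u ∈ vs
    link-end e∈ (link (inj₁ refl) _) = proj₂ (ends wf e∈)
    link-end e∈ (link (inj₂ refl) _) = proj₁ (ends wf e∈)

    nbs-opposite-leaves : ∀ {k x e₁ u e₂ y z} T g → Link e₁ x u → Link e₂ x y → z ≢ x →
      nbs (opposite-leaves k e₁ e₂ T) z g ≡ hit z u (g k x) + (hit z y (g (not k) x) + nbs T z g)
    nbs-opposite-leaves T g l₁ l₂ z≢x = trans (nbs-∷ _ _ _ g) (cong₂ _+_ (term-other g _ l₁ z≢x)
      (trans (nbs-∷ _ T _ g) (cong (_+ nbs T _ g) (term-other g _ l₂ z≢x))))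

    almost : ∀ {T z} → Colouring vs es T → z ∈ vs → ¬ Large z → (∀ v → v ≢ z → Near 5 T v) → Near 6 T z → Balanceable vs es
    almost {T} {z} C z∈ small h h₆ = T , C , all
      where
      all : ∀ v → Near 5 T v
      all v with v ≟ z
      ... | yes refl = not-large C z∈ small h₆
      ... | no v≢z = h v v≢z

    free-ends : ∀ {x T} → Free x T → Ends vs (map proj₂ T) → Ends (vs ∖ x) (map proj₂ T)
    free-ends free h i with ∈-map⁻ proj₂ i
    ... | (c , _) , j , refl = ∈-∖⁺ (proj₁ (h i)) (proj₁ (free j)) , ∈-∖⁺ (proj₂ (h i)) (proj₂ (free j))

    fewer : ∀ {x} → x ∈ vs → length (vs ∖ x) < length vs
    fewer x∈ = ≤-reflexive (sym (length-∖ (unique wf) x∈))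

    module _ {x : V} {e₁ : V × V} {u : V} {e₂ : V × V} {y : V} {T T′ : Coloured} {c : Bool} (x∈ : x ∈ vs) (C : Colouring vs es T) (p : T ↭ opposite-leaves c e₁ e₂ T′)
      (l₁ : Link e₁ x u) (l₂ : Link e₂ x y) (free : Free x T′) where

      private
        es-split : es ↭ e₁ ∷ e₂ ∷ map proj₂ T′
        es-split = ↭-trans (↭-sym (edges C)) (map⁺ proj₂ p)

        u∈ : u ∈ vs
        u∈ = link-end (∈-resp-↭ (↭-sym es-split) (here refl)) l₁

        y∈ : y ∈ vs
        y∈ = link-end (∈-resp-↭ (↭-sym es-split) (there (here refl))) l₂

      smaller₂ : WellFormed (vs ∖ x) (map proj₂ T′)
      smaller₂ = wellFormed (unique-∖ (unique wf))
        (free-ends free λ i → ends wf (∈-resp-↭ (↭-sym es-split) (there (there i))))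
        (bound _ _ (subst₂ (λ a b → a + 2 ≤ 2 * b) (↭-length es-split) (length-∖ (unique wf) x∈) (size wf)))
        where
        bound : ∀ m n → suc (suc m) + 2 ≤ 2 * suc n → m + 2 ≤ 2 * n
        bound m n h = ≤-pred (≤-pred (subst (suc (suc m) + 2 ≤_) (*-distribˡ-+ 2 1 n) h))

      rest-colouring : Colouring (vs ∖ x) (map proj₂ T′) T′
      rest-colouring = colouring ↭-refl (delete₂ l₁ l₂ free (spanning-↭ p (spans C)))

      extend₂ : ∀ {T″} → Colouring (vs ∖ x) (map proj₂ T′) T″ → ∀ k → Colouring vs es (opposite-leaves k e₁ e₂ T″)
      extend₂ C″ k = colouring (↭-trans (↭-prep _ (↭-prep _ (edges C″))) (↭-sym es-split)) (attach₂ l₁ l₂ u∈ y∈ (spans C″))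

      opaque
        -- Only one of the two colours at `x` can be chosen, since the other edge gets the opposite
        -- one. The choice is made in favour of `y`, and `u` bears the change. If `u` and `y`
        -- coincide, both colours grow by one there and no discrepancy changes.
        reduce₂ : deg x ≡ 2 → ∃[ S ] (Colouring vs es S × (∀ v → v ≢ u → Near 5 S v) × Near 6 S u × (u ≡ y → Near 5 S u))
        reduce₂ d with ih (fewer x∈) smaller₂ (T′ , rest-colouring)
        ... | T″ , C″ , bal with favour (λ c → cdeg T″ c y) (bal y)
        ... | k , fav = S , CS , elsewhere , at-u , double
          where
          S : Coloured
          S = opposite-leaves k e₁ e₂ T″
          CS : Colouring vs es S
          CS = extend₂ C″ k
          at : ∀ {v} c → v ≢ x → cdeg S c v ≡ hit v u (δ c k) + (hit v y (δ c (not k)) + cdeg T″ c v)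
          at c = nbs-opposite-leaves T″ _ l₁ l₂
          elsewhere : ∀ v → v ≢ u → Near 5 S v
          elsewhere v v≢u with v ≟ x
          ... | yes refl = low-degree CS (≤-trans (≤-reflexive d) (m≤m+n 2 3))
          ... | no v≢x with v ≟ y
          ... | yes refl = λ c → subst₂ (λ a b → a ≤ 5 + b) (sym (eq c)) (sym (eq (not c))) (fav c)
            where
            eq : ∀ c → cdeg S c v ≡ δ c (not k) + cdeg T″ c v
            eq c = trans (at c v≢x) (cong₂ _+_ (hit-≢ _ v≢u) (cong (_+ cdeg T″ c v) (hit-≡ v _)))
          ... | no v≢y = near-cong {T′ = T″} (λ c → trans (at c v≢x) (cong₂ _+_ (hit-≢ _ v≢u) (cong (_+ cdeg T″ c v) (hit-≢ _ v≢y)))) (bal v)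
          double : u ≡ y → Near 5 S u
          double refl c = subst₂ (λ a b → a ≤ 5 + b) (sym (eq c)) (sym (eq (not c))) (s≤s (bal u c))
            where
            eq : ∀ c → cdeg S c u ≡ suc (cdeg T″ c u)
            eq c = trans (at c (proper l₁)) (trans (cong₂ _+_ (hit-≡ u _) (cong (_+ cdeg T″ c u) (hit-≡ u _)))
                     (trans (sym (+-assoc (δ c k) _ _)) (cong (_+ cdeg T″ c u) (δ-sumʳ c k))))
          at-u : Near 6 S u
          at-u with u ≟ y
          ... | yes u≡y = near-weaken {T = S} (double u≡y)
          ... | no u≢y = λ c → subst₂ (λ a b → a ≤ 6 + b) (sym (eq c)) (sym (eq (not c))) (shift-near {5} {g = cdeg T″ (not c) u} (bal u c) (δ≤1 c k))
            where
            eq : ∀ c → cdeg S c u ≡ δ c k + cdeg T″ c u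
            eq c = trans (at c (proper l₁)) (cong₂ _+_ (hit-≡ u _) (cong (_+ cdeg T″ c u) (hit-≢ _ u≢y)))

      small-neighbour₂ : deg x ≡ 2 → ¬ Large u → Balanceable vs es
      small-neighbour₂ d small with reduce₂ d
      ... | S , CS , h , h₆ , _ = almost CS u∈ small h h₆

    -- The induction may give the edge `ad` any colour `k`. Subdividing it by `x` in that colour
    -- keeps the colour degrees of `a` and `d`, and `x` joins the other class through `e₃`; only `b`
    -- is disturbed.
    small-neighbour₃ : ∀ {x e₁ a e₂ d e₃ b T₀ T′} → x ∈ vs → deg x ≡ 3 → es ↭ e₁ ∷ e₂ ∷ e₃ ∷ map proj₂ T₀ →
      Link e₁ x a → Link e₂ x d → Link e₃ x b → Free x T₀ →
      Spanning (vs ∖ x) T′ → map proj₂ T′ ≡ (a , d) ∷ map proj₂ T₀ → ¬ Large b → Balanceable vs es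
    small-neighbour₃ {x} {e₁} {a} {e₂} {d} {e₃} {b} {T₀} {T′} x∈ deg3 q l₁ l₂ l₃ free s und small
      with ih (fewer x∈) smaller (T′ , colouring (↭-reflexive und) s)
      where
      a∈ = ∈-∖⁺ (link-end (∈-resp-↭ (↭-sym q) (here refl)) l₁) (proper l₁)
      d∈ = ∈-∖⁺ (link-end (∈-resp-↭ (↭-sym q) (there (here refl))) l₂) (proper l₂)
      bound : ∀ m n → suc (suc (suc m)) + 2 ≤ 2 * suc n → suc m + 2 ≤ 2 * n
      bound m n h = ≤-pred (≤-pred (subst (suc (suc (suc m)) + 2 ≤_) (*-distribˡ-+ 2 1 n) h))
      smaller : WellFormed (vs ∖ x) ((a , d) ∷ map proj₂ T₀)
      smaller = wellFormed (unique-∖ (unique wf))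
        (λ { (here refl) → a∈ , d∈
           ; (there i) → free-ends free (λ j → ends wf (∈-resp-↭ (↭-sym q) (there (there (there j))))) i })
        (bound _ _ (subst₂ (λ a b → a + 2 ≤ 2 * b) (↭-length q) (length-∖ (unique wf) x∈) (size wf)))
    ... | T″ , C″ , bal with ∈-map⁻ proj₂ (∈-resp-↭ (↭-sym (edges C″)) (here refl))
    ... | (k , _) , i , refl with ∈⇒↭ i
    ... | T‴ , r = almost CS b∈ small elsewhere at-b
      where
      a∈ = link-end (∈-resp-↭ (↭-sym q) (here refl)) l₁
      b∈ = link-end (∈-resp-↭ (↭-sym q) (there (there (here refl)))) l₃
      S = (k , e₁) ∷ (k , e₂) ∷ (not k , e₃) ∷ T‴
      und‴ : map proj₂ T‴ ↭ map proj₂ T₀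
      und‴ = drop-∷ (↭-trans (↭-sym (map⁺ proj₂ r)) (edges C″))
      CS : Colouring vs es S
      CS = colouring (↭-trans (↭-prep _ (↭-prep _ (↭-prep _ und‴))) (↭-sym q)) (attach₃ l₁ l₂ l₃ a∈ b∈ (spanning-↭ r (spans C″)))
      at : ∀ {v} c → v ≢ x → cdeg S c v ≡ hit v b (δ c (not k)) + cdeg T″ c v
      at {v} c v≢x = trans (nbs-at _ v)
          (trans (cong₂ _+_ (term-other (λ k _ → δ c k) _ l₁ v≢x) (cong₂ _+_ (term-other (λ k _ → δ c k) _ l₂ v≢x) (cong (_+ cdeg T‴ c v) (term-other (λ k _ → δ c k) _ l₃ v≢x))))
        (trans (arith (hit v a (δ c k)) (hit v d (δ c k)) (hit v b (δ c (not k))) (cdeg T‴ c v))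
               (cong (hit v b (δ c (not k)) +_) (sym (trans (nbs-↭ v _ r) (nbs-∷ _ T‴ v _))))))
        where
        nbs-at : ∀ g v → nbs S v g ≡ term g v (k , e₁) + (term g v (k , e₂) + (term g v (not k , e₃) + nbs T‴ v g))
        nbs-at g v = trans (nbs-∷ _ _ v g) (cong (_ +_) (trans (nbs-∷ _ _ v g) (cong (_ +_) (nbs-∷ _ T‴ v g))))
        arith : ∀ a d b t → a + (d + (b + t)) ≡ b + (a + d + t)
        arith = solve-∀
      elsewhere : ∀ v → v ≢ b → Near 5 S v
      elsewhere v v≢b with v ≟ x
      ... | yes refl = low-degree CS (≤-trans (≤-reflexive deg3) (m≤m+n 3 2))
      ... | no v≢x = near-cong {T′ = T″} (λ c → trans (at c v≢x) (cong (_+ cdeg T″ c v) (hit-≢ _ v≢b))) (bal v)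
      at-b : Near 6 S b
      at-b c = subst₂ (λ a b → a ≤ 6 + b) (sym (eq c)) (sym (eq (not c))) (shift-near {5} {g = cdeg T″ (not c) b} (bal b c) (δ≤1 c (not k)))
        where
        eq : ∀ c → cdeg S c b ≡ δ c (not k) + cdeg T″ c b
        eq c = trans (at c (proper l₃)) (cong (_+ cdeg T″ c b) (hit-≡ b _))

    -- An exchange at `v` preserves the colour degrees of `v`. It takes an edge of colour `κ` from
    -- `p` and gives one to `q`, with the reverse effect in the other colour: this is how excess
    -- travels.
    record Flex (T : Coloured) (κ : Bool) (v : V) : Set where
      field
        {p q} : V
        {e₁ e₂} : V × V
        {T′} : Coloured
        split : T ↭ opposite-leaves κ e₁ e₂ T′
        l₁ : Link e₁ v p
        l₂ : Link e₂ v q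
        large-p : Large p
        large-q : Large q
        flipped : Colouring vs es ((not κ , e₁) ∷ (κ , e₂) ∷ T′)

    flex-opposite : ∀ {T κ v} → Flex T κ v → Flex T (not κ) v
    flex-opposite {T} {κ} {v} F = record
      { split = opposite-swap split
      ; l₁ = l₂ ; l₂ = l₁ ; large-p = large-q ; large-q = large-p
      ; flipped = subst (λ k → Colouring vs es ((k , e₂) ∷ (not κ , e₁) ∷ T′)) (sym (not-involutive κ))
          (colouring (↭-trans (↭-swap _ _ ↭-refl) (edges flipped)) (spanning-↭ (↭-swap _ _ ↭-refl) (spans flipped))) }
      where open Flex F

    flex-any : ∀ {T c v} → Flex T c v → ∀ κ → Flex T κ v
    flex-any {c = c} F κ with colour-cases c κ
    ... | inj₁ refl = F
    ... | inj₂ refl = flex-opposite F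

    -- A leaf of both trees can always trade its two colours; only the size of its neighbours is in
    -- question.
    flex₂ : ∀ {T x} → Colouring vs es T → x ∈ vs → deg x ≡ 2 → Balanceable vs es ⊎ (∀ κ → Flex T κ x)
    flex₂ {T} {x} C x∈ d =
      let w , w∈ , w≢x = other x
          e , u , e′ , y , T′ , p , l₁ , l₂ , n = opposite-edges (spans C) x∈ w∈ w≢x
      in decide p l₁ l₂ (degree-zero (suc-injective (suc-injective (trans (sym n) (trans (nbs≡usum C x _) d))))) (large? u) (large? y)
      where
      decide : ∀ {e u e′ y T′} → T ↭ opposite-leaves true e e′ T′ → Link e x u → Link e′ x y → Free x T′ →
        Dec (Large u) → Dec (Large y) → Balanceable vs es ⊎ (∀ κ → Flex T κ x)
      decide p l₁ l₂ free (no ¬u) _ = inj₁ (small-neighbour₂ x∈ C p l₁ l₂ free d ¬u)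
      decide p l₁ l₂ free (yes _) (no ¬y) = inj₁ (small-neighbour₂ x∈ C (↭-trans p (↭-swap _ _ ↭-refl)) l₂ l₁ free d ¬y)
      decide p l₁ l₂ free (yes Lu) (yes Ly) = inj₂ (flex-any record
        { split = p ; l₁ = l₁ ; l₂ = l₂ ; large-p = Lu ; large-q = Ly
        ; flipped = extend₂ x∈ C p l₁ l₂ free (rest-colouring x∈ C p l₁ l₂ free) false })

    -- e₁ keeps its colour, while e₂ and e₃ may exchange theirs.
    exchange : ∀ {T x c e₁ a e₂ d e₃ b T′} → Colouring vs es T → x ∈ vs → deg x ≡ 3 →
      T ↭ (c , e₁) ∷ (c , e₂) ∷ (not c , e₃) ∷ T′ → Link e₁ x a → Link e₂ x d → Link e₃ x b → Free x T′ →
      Con T′ c b d → Dec (Large d) → Dec (Large b) → Balanceable vs es ⊎ (∀ κ → Flex T κ x)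
    exchange {T} {x} {c} {e₁} {a} {e₂} {d} {e₃} {b} {T′} C x∈ deg3 p l₁ l₂ l₃ free k = decide
      where
      q : es ↭ e₁ ∷ e₂ ∷ e₃ ∷ map proj₂ T′
      q = ↭-trans (↭-sym (edges C)) (map⁺ proj₂ p)
      span : Spanning vs ((c , e₁) ∷ (c , e₂) ∷ (not c , e₃) ∷ T′)
      span = spanning-↭ p (spans C)
      moved : Spanning (vs ∖ x) ((c , a , b) ∷ T′)
      moved = delete₃ l₁ l₂ l₃ free (edge (here refl) ◅◅ con-⊆ (edge ∘ there) k) span
      swapped : Spanning vs ((c , e₁) ∷ (c , e₃) ∷ (not c , e₂) ∷ T′)
      swapped = attach₃ l₁ l₃ l₂ (link-end (∈-resp-↭ (↭-sym q) (here refl)) l₁) (link-end (∈-resp-↭ (↭-sym q) (there (here refl))) l₂) moved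
      decide : Dec (Large d) → Dec (Large b) → Balanceable vs es ⊎ (∀ κ → Flex T κ x)
      decide (yes Ld) (yes Lb) = inj₂ (flex-any record
        { split = ↭-trans p (↭-trans (↭-swap _ _ ↭-refl) (↭-prep _ (↭-swap _ _ ↭-refl)))
        ; l₁ = l₂ ; l₂ = l₃ ; large-p = Ld ; large-q = Lb
        ; flipped = colouring (↭-trans (↭-trans (↭-prep _ (↭-swap _ _ ↭-refl)) (↭-swap _ _ ↭-refl)) (↭-sym q))
            (spanning-↭ (↭-trans (↭-prep _ (↭-swap _ _ ↭-refl)) (↭-trans (↭-swap _ _ ↭-refl) (↭-prep _ (↭-swap _ _ ↭-refl)))) swapped) })
      -- If `b` is small, the new edge `ad` leaves the disturbance at `b`. If `d` is small, the
      -- exchange is carried out first: the new edge is `ab`, and `d` takes the role of the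
      -- disturbed vertex.
      decide (yes _) (no ¬b) = inj₁ (small-neighbour₃ x∈ deg3 q l₁ l₂ l₃ free (delete₃ l₁ l₂ l₃ free (edge (here refl)) span) refl ¬b)
      decide (no ¬d) _ = inj₁ (small-neighbour₃ x∈ deg3 (↭-trans q (↭-prep _ (↭-swap _ _ ↭-refl))) l₁ l₃ l₂ free moved refl ¬d)

    flex₃ : ∀ {T x} → Colouring vs es T → x ∈ vs → deg x ≡ 3 → Balanceable vs es ⊎ (∀ κ → Flex T κ x)
    flex₃ {T} {x} C x∈ deg3 =
      let w , w∈ , w≢x = other x
          c , e₁ , a , e₂ , d , e₃ , b , T′ , p , l₁ , l₂ , l₃ , free =
            degree-three (spans C) x∈ w∈ w≢x (trans (nbs≡usum C x _) deg3)
          b∈ = link-end (in-es C (∈-resp-↭ (↭-sym p) (there (there (here refl))))) l₃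
      in choose p l₁ l₂ l₃ free (side l₁ l₂ l₃ free (spanning-↭ p (spans C)) x∈ b∈)
      where
      choose : ∀ {c e₁ a e₂ d e₃ b T′} → T ↭ (c , e₁) ∷ (c , e₂) ∷ (not c , e₃) ∷ T′ → Link e₁ x a → Link e₂ x d → Link e₃ x b →
        Free x T′ → Con T′ c b a ⊎ Con T′ c b d → Balanceable vs es ⊎ (∀ κ → Flex T κ x)
      choose p l₁ l₂ l₃ free (inj₁ k) = exchange C x∈ deg3 (↭-trans p (↭-swap _ _ ↭-refl)) l₂ l₁ l₃ free k (large? _) (large? _)
      choose p l₁ l₂ l₃ free (inj₂ k) = exchange C x∈ deg3 p l₁ l₂ l₃ free k (large? _) (large? _)

-- Two vertices of degree 2 at a common large vertex.

module LeafPairs {V : Set} (_≟_ : DecidableEquality V) where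

  open Coloured _≟_
  open Link
  open Reductions _≟_
  open Colouring
  open WellFormed

  spanning-⊆ : ∀ {vs vs′ T} → (∀ {v} → v ∈ vs′ → v ∈ vs) → Spanning vs T → Spanning vs′ T
  spanning-⊆ h s c a∈ b∈ = s c (h a∈) (h b∈)

  ∖-comm : ∀ {vs x y v} → v ∈ vs ∖ x ∖ y → v ∈ vs ∖ y ∖ x
  ∖-comm {vs} {x} v∈ = let v∈′ , v≢y = ∈-∖⁻ {vs ∖ x} v∈ ; v∈vs , v≢x = ∈-∖⁻ {vs} v∈′ in ∈-∖⁺ (∈-∖⁺ v∈vs v≢y) v≢x

  opaque
    pull : ∀ {T : Coloured} {e es} → map proj₂ T ↭ e ∷ es → ∃[ k ] ∃[ T′ ] (T ↭ (k , e) ∷ T′ × map proj₂ T′ ↭ es)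
    pull p with ∈-map⁻ proj₂ (∈-resp-↭ (↭-sym p) (here refl))
    ... | (k , _) , i , refl with ∈⇒↭ i
    ... | T′ , q = k , T′ , q , drop-∷ (↭-trans (↭-sym (map⁺ proj₂ q)) p)

  module _ {vs : List V} {es : List (V × V)} (wf : WellFormed vs es)
    (other : ∀ x → ∃[ w ] (w ∈ vs × w ≢ x))
    (ih : ∀ {vs′ es′} → length vs′ < length vs → WellFormed vs′ es′ → ∃[ T ] Colouring vs′ es′ T → Balanceable vs′ es′)
    where
    open Instance wf other ih

    leaf? : V → ℕ
    leaf? o = ⟦ does (deg o ≟ⁿ 2) ⟧

    leaf-sound : ∀ {o} → 1 ≤ leaf? o → deg o ≡ 2
    leaf-sound {o} = dec-sound (deg o ≟ⁿ 2)

    leaf-complete : ∀ {o} → deg o ≡ 2 → leaf? o ≡ 1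
    leaf-complete {o} = dec-complete (deg o ≟ⁿ 2)

    large≢leaf : ∀ {u x} → Large u → deg x ≡ 2 → x ≢ u
    large≢leaf (8≤ , _) d refl with s≤s (s≤s ()) ← subst (8 ≤_) d 8≤

    opaque
      leaf-neighbour : ∀ {T u} → Large u → 1 ≤ nbs T u (λ _ → leaf?) →
        ∃[ c ] ∃[ e ] ∃[ x ] ((c , e) ∈ T × Link e x u × deg x ≡ 2)
      leaf-neighbour {T} {u} Lu h with nbs-positive T u (λ _ → leaf?) h
      ... | c , e , x , i , l , pos = c , e , x , i , link-sym (link l (large≢leaf Lu (leaf-sound pos))) , leaf-sound pos

    -- Two leaves x, x′ of both trees at u, with further neighbours y and z, act on the balance like a
    -- single vertex joined to y and z.
    module _ {T : Coloured} {u x y x′ z : V} {c c′ : Bool} {e e₁ e′ e₂ : V × V} {T′ T″ : Coloured} (C : Colouring vs es T)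
      (p : T ↭ opposite-leaves c e e₁ T′) (p′ : T′ ↭ opposite-leaves c′ e′ e₂ T″)
      (l : Link e x u) (l₁ : Link e₁ x y) (l′ : Link e′ x′ u) (l₂ : Link e₂ x′ z)
      (free : Free x T′) (free′ : Free x′ T″) (d : deg x ≡ 2) (d′ : deg x′ ≡ 2) (x′≢x : x′ ≢ x) (x′≢y : x′ ≢ y)
      where

      private
        es-split : es ↭ e ∷ e₁ ∷ e′ ∷ e₂ ∷ map proj₂ T″
        es-split = ↭-trans (↭-sym (edges C)) (map⁺ proj₂ (↭-trans p (↭-prep _ (↭-prep _ p′))))
        back : ∀ {f} → f ∈ e ∷ e₁ ∷ e′ ∷ e₂ ∷ map proj₂ T″ → f ∈ es
        back = ∈-resp-↭ (↭-sym es-split)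
        x∈ : x ∈ vs
        x∈ = link-end (back (here refl)) (link-sym l)
        u∈ : u ∈ vs
        u∈ = link-end (back (here refl)) l
        y∈ : y ∈ vs
        y∈ = link-end (back (there (here refl))) l₁
        x′∈ : x′ ∈ vs
        x′∈ = link-end (back (there (there (here refl)))) (link-sym l′)
        z∈ : z ∈ vs
        z∈ = link-end (back (there (there (there (here refl))))) l₂
        i₂ : (not c′ , e₂) ∈ T′
        i₂ = ∈-resp-↭ (↭-sym p′) (there (here refl))
        z≢x : z ≢ x
        z≢x = far (Link.either l₂) (free i₂)
          where
          far : e₂ ≡ (x′ , z) ⊎ e₂ ≡ (z , x′) → proj₁ e₂ ≢ x × proj₂ e₂ ≢ x → z ≢ x
          far (inj₁ refl) = proj₂
          far (inj₂ refl) = proj₁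
        freeˣ : Free x T″
        freeˣ i = free (∈-resp-↭ (↭-sym p′) (there (there i)))
        ly : Link (x , y) x y
        ly = link (inj₁ refl) (proper l₁)
        lz : Link (x , z) x z
        lz = link (inj₁ refl) z≢x

        merged : List (V × V)
        merged = (x , y) ∷ (x , z) ∷ map proj₂ T″

        merged-wf : WellFormed (vs ∖ x′) merged
        merged-wf = wellFormed (unique-∖ (unique wf)) ends′
          (bound (length merged) _ (subst₂ (λ a b → a + 2 ≤ 2 * b) (↭-length es-split) (length-∖ (unique wf) x′∈) (size wf)))
          where
          bound : ∀ m n → suc (suc m) + 2 ≤ 2 * suc n → m + 2 ≤ 2 * n
          bound m n h = ≤-pred (≤-pred (subst (suc (suc m) + 2 ≤_) (*-distribˡ-+ 2 1 n) h))
          ends′ : Ends (vs ∖ x′) merged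
          ends′ (here refl) = ∈-∖⁺ x∈ (x′≢x ∘ sym) , ∈-∖⁺ y∈ (x′≢y ∘ sym)
          ends′ (there (here refl)) = ∈-∖⁺ x∈ (x′≢x ∘ sym) , ∈-∖⁺ z∈ (proper l₂)
          ends′ (there (there i)) = free-ends free′ (λ j → ends wf (back (there (there (there (there j)))))) i

        merged-colouring : Colouring (vs ∖ x′) merged (opposite-leaves c (x , y) (x , z) T″)
        merged-colouring = colouring ↭-refl
          (attach₂ ly lz (∈-∖⁺ y∈ (x′≢y ∘ sym)) (∈-∖⁺ z∈ (proper l₂))
            (spanning-⊆ (∖-comm {vs}) (delete₂ l′ l₂ free′ (spanning-↭ p′ (delete₂ l l₁ free (spanning-↭ p (spans C)))))))

        expand : ∀ {S} → Colouring (vs ∖ x′) merged S → (∀ v → Near 5 S v) →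
          ∀ {k k′ S′ W} → S ↭ (k , x , y) ∷ S′ → S′ ↭ (k′ , x , z) ∷ W → map proj₂ W ↭ map proj₂ T″ → Balanceable vs es
        expand {S} CS bal {k} {k′} {S′} {W} q q′ und with colour-cases k k′
        -- With both edges at `x` of colour `k`, the other class could not leave `x`.
        ... | inj₁ refl = ⊥-elim (no-other (leaving-edge (spans CS (not k) (∈-∖⁺ x∈ (x′≢x ∘ sym)) (∈-∖⁺ y∈ (x′≢y ∘ sym))) (proper l₁)))
          where
          freeᵂ : Free x W
          freeᵂ {a = a} {b} i with ∈-map⁻ proj₂ (∈-resp-↭ und (∈-map⁺ proj₂ i))
          ... | _ , j , refl = freeˣ j
          no-other : ¬ (∃[ f ] ∃[ w ] ((not k , f) ∈ S × Link f x w))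
          no-other (f , w , i , lf) with ∈-resp-↭ (↭-trans q (↭-prep _ q′)) i
          ... | here eq = c≢not (sym (cong proj₁ eq))
          ... | there (here eq) = c≢not (sym (cong proj₁ eq))
          no-other (f , w , i , link (inj₁ refl) _) | there (there j) = proj₁ (freeᵂ j) refl
          no-other (f , w , i , link (inj₂ refl) _) | there (there j) = proj₂ (freeᵂ j) refl
        ... | inj₂ refl = R , CR , balanced
          where
          freeᵂ : Free x W
          freeᵂ {a = a} {b} i with ∈-map⁻ proj₂ (∈-resp-↭ und (∈-map⁺ proj₂ i))
          ... | _ , j , refl = freeˣ j
          r : S ↭ opposite-leaves k (x , y) (x , z) W
          r = ↭-trans q (↭-prep _ q′)
          -- The edges to `y` and `z` keep the colours they have in `S`. The two edges at `u` then
          -- receive opposite colours, so the discrepancy of `u` is that of `S`.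
          R : Coloured
          R = opposite-leaves k e₁ e (opposite-leaves k e′ e₂ W)
          CR : Colouring vs es R
          CR = colouring (↭-trans (↭-trans (↭-swap _ _ (↭-prep _ (↭-prep _ und))) ↭-refl) (↭-sym es-split))
            (attach₂ l₁ l y∈ u∈ (attach₂ l′ l₂ (∈-∖⁺ u∈ (proper l)) (∈-∖⁺ z∈ z≢x)
              (spanning-⊆ (∖-comm {vs}) (delete₂ ly lz freeᵂ (spanning-↭ r (spans CS))))))
          eq : ∀ {v} c → v ≢ x → v ≢ x′ → cdeg R c v ≡ hit v u 1 + cdeg S c v
          eq {v} c v≢x v≢x′ = begin
            cdeg R c v
              ≡⟨ nbs-opposite-leaves _ (λ k _ → δ c k) l₁ l v≢x ⟩
            hit v y (δ c k) + (hit v u (δ c (not k)) + cdeg (opposite-leaves k e′ e₂ W) c v)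
              ≡⟨ cong (λ t → hit v y (δ c k) + (hit v u (δ c (not k)) + t)) (nbs-opposite-leaves _ (λ k _ → δ c k) l′ l₂ v≢x′) ⟩
            hit v y (δ c k) + (hit v u (δ c (not k)) + (hit v u (δ c k) + (hit v z (δ c (not k)) + cdeg W c v)))
              ≡⟨ arith (hit v y (δ c k)) (hit v u (δ c (not k))) (hit v u (δ c k)) (hit v z (δ c (not k))) (cdeg W c v) ⟩
            (hit v u (δ c k) + hit v u (δ c (not k))) + (hit v y (δ c k) + (hit v z (δ c (not k)) + cdeg W c v))
              ≡⟨ cong₂ _+_ (trans (sym (hit-+ v u _ _)) (cong (hit v u) (δ-sumʳ c k)))
                   (sym (trans (nbs-↭ v _ r) (nbs-opposite-leaves _ (λ k _ → δ c k) ly lz v≢x))) ⟩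
            hit v u 1 + cdeg S c v ∎
            where
            open ≡-Reasoning
            arith : ∀ a b c d e → a + (b + (c + (d + e))) ≡ (c + b) + (a + (d + e))
            arith = solve-∀
          balanced : ∀ v → Near 5 R v
          balanced v with v ≟ x | v ≟ x′
          ... | yes refl | _ = low-degree CR (≤-trans (≤-reflexive d) (m≤m+n 2 3))
          ... | no _ | yes refl = low-degree CR (≤-trans (≤-reflexive d′) (m≤m+n 2 3))
          ... | no v≢x | no v≢x′ = λ c → subst₂ (λ a b → a ≤ 5 + b) (sym (eq c v≢x v≢x′)) (sym (eq (not c) v≢x v≢x′))
            (≤-trans (+-monoʳ-≤ (hit v u 1) (bal v c)) (≤-reflexive (arith (hit v u 1) (cdeg S (not c) v))))
            where
            arith : ∀ h g → h + (5 + g) ≡ 5 + (h + g)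
            arith = solve-∀

      opaque
        leaf-pair : Balanceable vs es
        leaf-pair =
          let S , CS , bal = ih (fewer x′∈) merged-wf (_ , merged-colouring)
              k , S′ , q , und = pull (edges CS)
              k′ , W , q′ , und′ = pull und
          in expand CS bal q q′ und′

    -- Leaves are counted with multiplicity, so a single vertex doubly joined to `u` must be treated
    -- apart. Otherwise the further neighbour `y` is either small, which settles the matter, or
    -- large and hence not a leaf, and a second leaf remains at `u` after the deletion of the first.
    two-leaves : ∀ {T u} → Colouring vs es T → Large u → 2 ≤ usum es u leaf? → Balanceable vs es
    two-leaves {T} {u} C Lu h =
      let c , e , x , i , l , d = leaf-neighbour {T} Lu (≤-trans (s≤s z≤n) (subst (2 ≤_) (sym (nbs≡usum C u leaf?)) h))
          e₁ , y , T′ , p , l₁ , free = degree-two-at (spans C) (link-end (in-es C i) (link-sym l)) (link-end (in-es C i) l) (proper l) (trans (nbs≡usum C x _) d) i l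
      in go d l l₁ p free (link-end (in-es C i) (link-sym l)) (y ≟ u) (large? y)
      where
      go : ∀ {c e x e₁ y T′} → deg x ≡ 2 → Link e x u → Link e₁ x y → T ↭ opposite-leaves c e e₁ T′ → Free x T′ → x ∈ vs →
        Dec (y ≡ u) → Dec (Large y) → Balanceable vs es
      go d l l₁ p free x∈ (yes refl) _ =
        let S , CS , h , _ , h′ = reduce₂ x∈ C p l l₁ free d in S , CS , λ v → at S h (h′ refl) v (v ≟ u)
        where
        at : ∀ S → (∀ v → v ≢ u → Near 5 S v) → Near 5 S u → ∀ v → Dec (v ≡ u) → Near 5 S v
        at S h h′ v (yes refl) = h′
        at S h h′ v (no n) = h v n
      go d l l₁ p free x∈ (no _) (no small) = small-neighbour₂ x∈ C (opposite-swap p) l₁ l free d small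
      go {c} {e} {x} {e₁} {y} {T′} d l l₁ p free x∈ (no y≢u) (yes Ly) =
        let c′ , e′ , x′ , i′ , l′ , d′ = leaf-neighbour {T′} Lu again
            x′≢x = apart (Link.either l′) (free i′)
            x′≢y = large≢leaf Ly d′
            in-es′ = λ {f} (j : f ∈ T′) → in-es C (∈-resp-↭ (↭-sym p) (there (there j)))
            deg′ = trans (sym (trans (nbs-↭ x′ one p) (trans (nbs-opposite-leaves T′ one l l₁ x′≢x)
                     (cong₂ _+_ (hit-≢ 1 (proper l′ ∘ sym)) (cong (_+ nbs T′ x′ one) (hit-≢ 1 x′≢y))))))
                     (trans (nbs≡usum C x′ _) d′)
            e₂ , z , T″ , p′ , l₂ , free′ = degree-two-at (delete₂ l l₁ free (spanning-↭ p (spans C)))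
              (∈-∖⁺ (link-end (in-es′ i′) (link-sym l′)) x′≢x) (∈-∖⁺ (link-end (in-es′ i′) l′) (proper l)) (proper l′) deg′ i′ l′
        in leaf-pair C p p′ l l₁ l′ l₂ free free′ d d′ x′≢x x′≢y
        where
        apart : ∀ {e′ x′ u} → e′ ≡ (x′ , u) ⊎ e′ ≡ (u , x′) → proj₁ e′ ≢ x × proj₂ e′ ≢ x → x′ ≢ x
        apart (inj₁ refl) = proj₁
        apart (inj₂ refl) = proj₂
        again : 1 ≤ nbs T′ u (λ _ → leaf?)
        again = ≤-pred (subst (2 ≤_) total (subst (2 ≤_) (sym (nbs≡usum C u leaf?)) h))
          where
          total : nbs T u (λ _ → leaf?) ≡ suc (nbs T′ u (λ _ → leaf?))
          total = trans (nbs-↭ u _ p) (trans (nbs-opposite-leaves T′ _ l l₁ (proper l))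
            (cong₂ _+_ (trans (hit-≡ u _) (leaf-complete d)) (cong (_+ nbs T′ u (λ _ → leaf?)) (hit-≢ _ (y≢u ∘ sym)))))

-- Pushing an excess along movers.

one? : ℕ → ℕ
one? n = ⟦ does (n ≟ⁿ 1) ⟧

-- p and q are the large neighbours of a mover, p in the colour of the excess; s, r : membership in S, R.
boundary : ∀ sp rp sq rq → ¬ (sp ≡ true × rp ≡ true) → ¬ (sq ≡ true × rq ≡ true) → (rp ≡ true → rq ≡ true ⊎ sq ≡ true) →
  ⟦ rp ⟧ + one? (⟦ sp ∨ rp ⟧ + ⟦ sq ∨ rq ⟧) ≤ ⟦ rq ⟧ + one? (⟦ sp ⟧ + ⟦ sq ⟧)
boundary true true _ _ h _ _ = contradiction (refl , refl) h
boundary _ _ true true _ h _ = contradiction (refl , refl) h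
boundary true false true false _ _ _ = z≤n
boundary true false false true _ _ _ = z≤n
boundary true false false false _ _ _ = ≤-refl
boundary false true true false _ _ _ = ≤-refl
boundary false true false true _ _ _ = ≤-refl
boundary false true false false _ _ h with h refl
... | inj₁ ()
... | inj₂ ()
boundary false false true false _ _ _ = ≤-refl
boundary false false false true _ _ _ = ≤-refl
boundary false false false false _ _ _ = ≤-refl

module Tokens {V : Set} (_≟_ : DecidableEquality V) where

  open Coloured _≟_
  open Link
  open Reductions _≟_
  open Colouring
  open WellFormed
  open LeafPairs _≟_

  near-pair : ∀ {k T v} κ → cdeg T κ v ≤ k + cdeg T (not κ) v → cdeg T (not κ) v ≤ k + cdeg T κ v → Near k T v
  near-pair {k} {T} {v} κ h h′ c with colour-cases κ c
  ... | inj₁ refl = h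
  ... | inj₂ refl = subst (λ x → cdeg T (not κ) v ≤ k + cdeg T x v) (sym (not-involutive κ)) h′

  swap-count : ∀ {vs} T → Unique vs → Ends vs (map proj₂ T) → (f : V → Bool → V → ℕ) →
    ∑ vs (λ u → nbs T u (f u)) ≡ ∑ vs (λ v → nbs T v (λ c o → f o c v))
  swap-count T un ends f = trans (double-count T un ends f)
    (trans (∑-cong T λ {e} _ → +-comm (f (proj₁ (proj₂ e)) (proj₁ e) (proj₂ (proj₂ e))) _)
           (sym (double-count T un ends (λ v c o → f o c v))))

  module Spread {vs : List V} {es : List (V × V)} (wf : WellFormed vs es)
    (other : ∀ x → ∃[ w ] (w ∈ vs × w ≢ x))
    (ih : ∀ {vs′ es′} → length vs′ < length vs → WellFormed vs′ es′ → ∃[ T ] Colouring vs′ es′ T → Balanceable vs′ es′)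
    where
    open Instance wf other ih

    isLarge : V → Bool
    isLarge v = does (large? v)

    largeNbs : V → ℕ
    largeNbs v = usum es v (λ o → ⟦ isLarge o ⟧)

    -- Since the ends of an exchange are large, exactly two large neighbours make the exchangeable
    -- pair the same in every colouring. With three, different colourings could offer different
    -- pairs, and the excess could not be traced.
    Mover : V → Set
    Mover v = deg v ≡ 2 ⊎ (deg v ≡ 3 × largeNbs v ≡ 2)

    mover? : ∀ v → Dec (Mover v)
    mover? v = (deg v ≟ⁿ 2) ⊎-dec ((deg v ≟ⁿ 3) ×-dec (largeNbs v ≟ⁿ 2))

    isMover : V → Bool
    isMover v = does (mover? v)

    -- The number of edges at `u` along which no excess can be passed on.
    ρ : V → ℕ
    ρ u = usum es u (λ o → ⟦ not (isMover o) ⟧)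

    cut : (V → Bool) → V → ℕ
    cut S v = ⟦ isMover v ⟧ * one? (usum es v (λ o → ⟦ S o ⟧))

    -- The discharging uses only that 4|S| is at most the sum of `ρ` over `S`. The term with `cut`
    -- makes the inequality extend to larger sets: an excess that later runs into `S` does so
    -- through a mover cut by `S`, and the union no longer cuts that mover.
    record Saturated (S : V → Bool) : Set where
      field
        large : ∀ {v} → S v ≡ true → Large v
        dense : 4 * ∑ vs (λ v → ⟦ S v ⟧) + ∑ vs (cut S) ≤ ∑ vs (λ v → ⟦ S v ⟧ * ρ v)

    mover≢large : ∀ {v u} → Mover v → Large u → v ≢ u
    mover≢large (inj₁ d) (8≤ , _) refl with s≤s (s≤s ()) ← subst (8 ≤_) d 8≤
    mover≢large (inj₂ (d , _)) (8≤ , _) refl with s≤s (s≤s (s≤s ())) ← subst (8 ≤_) d 8≤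

    opaque
      flexM : ∀ {T v} → Colouring vs es T → v ∈ vs → Mover v → Balanceable vs es ⊎ (∀ κ → Flex T κ v)
      flexM C v∈ (inj₁ d) = flex₂ C v∈ d
      flexM C v∈ (inj₂ (d , _)) = flex₃ C v∈ d

    nbs-split : ∀ {T κ v} (F : Flex T κ v) g → let open Flex F in
      nbs T v g ≡ g κ p + (g (not κ) q + nbs T′ v g)
    nbs-split {T} {κ} {v} F g = trans (nbs-↭ v g split) (trans (nbs-∷ _ _ v g)
        (cong₂ _+_ (term-self g κ l₁) (trans (nbs-∷ _ T′ v g) (cong (_+ nbs T′ v g) (term-self g (not κ) l₂)))))
      where open Flex F

    large-one : ∀ {v} → Large v → ⟦ isLarge v ⟧ ≡ 1
    large-one {v} = dec-complete (large? v)

    rest-small : ∀ {T κ v} → Colouring vs es T → Mover v → (F : Flex T κ v) → nbs (Flex.T′ F) v (λ _ o → ⟦ isLarge o ⟧) ≡ 0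
    rest-small {T} {κ} {v} C (inj₁ d) F = n≤0⇒n≡0 (≤-trans (nbs-mono T′ v λ _ o → ⟦⟧≤1 (isLarge o)) (≤-reflexive none))
      where
      open Flex F
      none : nbs T′ v one ≡ 0
      none = suc-injective (suc-injective (trans (sym (nbs-split F one)) (trans (nbs≡usum C v _) d)))
    rest-small {T} {κ} {v} C (inj₂ (_ , k)) F = suc-injective (suc-injective (trans (sym expand) (trans (nbs≡usum C v _) k)))
      where
      open Flex F
      expand : nbs T v (λ _ o → ⟦ isLarge o ⟧) ≡ suc (suc (nbs T′ v (λ _ o → ⟦ isLarge o ⟧)))
      expand = trans (nbs-split F _) (cong₂ (λ a b → a + (b + nbs T′ v (λ _ o → ⟦ isLarge o ⟧))) (large-one large-p) (large-one large-q))

    opaque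
      -- `p` and `q` exhaust the large neighbours of a mover, with multiplicity.
      flex-count : ∀ {T κ v} → Colouring vs es T → Mover v → (F : Flex T κ v) → ∀ g → (∀ c o → g c o ≤ ⟦ isLarge o ⟧) →
        nbs T v g ≡ g κ (Flex.p F) + g (not κ) (Flex.q F)
      flex-count {T} {κ} {v} C m F g h = trans (nbs-split F g) (cong (g κ p +_)
          (trans (cong (g (not κ) q +_) (n≤0⇒n≡0 (≤-trans (nbs-mono T′ v h) (≤-reflexive (rest-small C m F))))) (+-identityʳ _)))
        where open Flex F

    -- T is the initial colouring, κ the colour of the excess 6 of its only unbalanced vertex.
    module Excess {S : V → Bool} (sat : Saturated S) {T : Coloured} (C : Colouring vs es T) (κ : Bool) where

      open Saturated sat

      Outcome : V → Set
      Outcome u = Balanceable vs es ⊎ ∃[ S′ ] (Saturated S′ × (∀ v → S v ≡ true → S′ v ≡ true) × S′ u ≡ true)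

      -- The excess has been pushed to w; movers with a large neighbour outside R still have their colours in T.
      record Token (R : V → Bool) (w : V) : Set where
        field
          {Tʷ} : Coloured
          colours : Colouring vs es Tʷ
          excess : cdeg Tʷ κ w ≡ 6 + cdeg Tʷ (not κ) w
          balanced : ∀ v → v ≢ w → Near 5 Tʷ v
          agree : ∀ v → Mover v → (∀ g → nbs Tʷ v g ≡ nbs T v g) ⊎ nbs T v (λ _ o → ⟦ isLarge o ∧ not (R o) ⟧) ≡ 0
          outside : ∀ z → R z ≡ false → ∀ c → cdeg Tʷ c z ≡ cdeg T c z

      -- Each vertex of `R` has a token in a colouring of its own, but `surplus` always refers to
      -- the one colouring `T`; hence it can be summed over `R`.
      record Reached (R : V → Bool) : Set where
        field
          vertex : ∀ {v} → R v ≡ true → v ∈ vs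
          largeᴿ : ∀ {v} → R v ≡ true → Large v
          disjoint : ∀ {v} → R v ≡ true → S v ≡ false
          surplus : ∀ {v} → R v ≡ true → 4 + cdeg T (not κ) v ≤ cdeg T κ v
          token : ∀ {w} → R w ≡ true → Token R w

      insert : (V → Bool) → V → V → Bool
      insert R q z = R z ∨ does (z ≟ q)

      insert-⊇ : ∀ R q {z} → R z ≡ true → insert R q z ≡ true
      insert-⊇ R q {z} h = cong (_∨ does (z ≟ q)) h

      insert-new : ∀ R q → insert R q q ≡ true
      insert-new R q rewrite dec-true (q ≟ q) refl with R q
      ... | true = refl
      ... | false = refl

      insert-false : ∀ R q {z} → insert R q z ≡ false → R z ≡ false × z ≢ q
      insert-false R q {z} h with R z | z ≟ q
      ... | false | no z≢q = refl , z≢q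

      shrink : ∀ R q → ∀ o → ⟦ isLarge o ∧ not (insert R q o) ⟧ ≤ ⟦ isLarge o ∧ not (R o) ⟧
      shrink R q o with isLarge o | R o
      ... | true | true = z≤n
      ... | true | false = ⟦⟧≤1 (not (does (o ≟ q)))
      ... | false | _ = z≤n

      agree-lift : ∀ R q {Tʷ v} → (∀ g → nbs Tʷ v g ≡ nbs T v g) ⊎ nbs T v (λ _ o → ⟦ isLarge o ∧ not (R o) ⟧) ≡ 0 →
        (∀ g → nbs Tʷ v g ≡ nbs T v g) ⊎ nbs T v (λ _ o → ⟦ isLarge o ∧ not (insert R q o) ⟧) ≡ 0
      agree-lift R q (inj₁ h) = inj₁ h
      agree-lift R q {v = v} (inj₂ h) = inj₂ (n≤0⇒n≡0 (≤-trans (nbs-mono T v λ _ → shrink R q) (≤-reflexive h)))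

      lift : ∀ {R q w} → Token R w → Token (insert R q) w
      lift {R} {q} t = record
        { colours = colours ; excess = excess ; balanced = balanced
        ; agree = λ v m → agree-lift R q (agree v m)
        ; outside = λ z h → outside z (proj₁ (insert-false R q h)) }
        where open Token t

      ∧-large : ∀ {v} b → Large v → ⟦ isLarge v ∧ b ⟧ ≡ ⟦ b ⟧
      ∧-large {v} b Lv = cong (λ x → ⟦ x ∧ b ⟧) (dec-true (large? v) Lv)

      -- The exchange at `v` lowers the excess of `p` from 6 to 4 and raises that of `q` by 2; all
      -- other colour degrees stay. By `closed`, the altered mover `v` has no large neighbour
      -- outside the enlarged set, as a token there requires.
      module Move {R : V → Bool} (D : Reached R) {v p q : V} {e₁ e₂ : V × V} {T′ : Coloured} (Rp : R p ≡ true) (Rq : R q ≡ false) (Sq : S q ≡ false)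
        (v∈ : v ∈ vs) (m : Mover v) (t : Token R p) (sp : Token.Tʷ t ↭ opposite-leaves κ e₁ e₂ T′)
        (l₁ : Link e₁ v p) (l₂ : Link e₂ v q) (Lp : Large p) (Lq : Large q)
        (C* : Colouring vs es ((not κ , e₁) ∷ (κ , e₂) ∷ T′))
        (closed : nbs T v (λ _ o → ⟦ isLarge o ∧ not (insert R q o) ⟧) ≡ 0) where

        open Token t
        open Reached D

        T* : Coloured
        T* = (not κ , e₁) ∷ (κ , e₂) ∷ T′

        p≢q : p ≢ q
        p≢q refl with () ← trans (sym Rp) Rq

        before : ∀ {z} g → z ≢ v → nbs Tʷ z g ≡ hit z p (g κ v) + (hit z q (g (not κ) v) + nbs T′ z g)
        before {z} g z≢v = trans (nbs-↭ z g sp) (nbs-opposite-leaves T′ g l₁ l₂ z≢v)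

        after : ∀ {z} g → z ≢ v → nbs T* z g ≡ hit z p (g (not κ) v) + (hit z q (g κ v) + nbs T′ z g)
        after {z} g z≢v = trans (nbs-∷ _ _ z g) (cong₂ _+_ (term-other g _ l₁ z≢v)
          (trans (nbs-∷ _ T′ z g) (cong (_+ nbs T′ z g) (term-other g _ l₂ z≢v))))

        unchanged : ∀ {z} g → z ≢ v → z ≢ p → z ≢ q → nbs T* z g ≡ nbs Tʷ z g
        unchanged {z} g z≢v z≢p z≢q = trans (trans (after g z≢v) (cong₂ (λ a b → a + (b + nbs T′ z g)) (hit-≢ _ z≢p) (hit-≢ _ z≢q)))
          (sym (trans (before g z≢v) (cong₂ (λ a b → a + (b + nbs T′ z g)) (hit-≢ _ z≢p) (hit-≢ _ z≢q))))

        same-degree : ∀ {z} c → z ≢ p → z ≢ q → cdeg T* c z ≡ cdeg Tʷ c z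
        same-degree {z} c z≢p z≢q with z ≟ v
        ... | no z≢v = unchanged _ z≢v z≢p z≢q
        ... | yes refl = begin
          nbs T* z g                                                 ≡⟨ nbs-∷ _ _ z g ⟩
          term g z (not κ , e₁) + nbs ((κ , e₂) ∷ T′) z g            ≡⟨ cong₂ _+_ (term-self g _ l₁) (trans (nbs-∷ _ T′ z g) (cong (_+ nbs T′ z g) (term-self g _ l₂))) ⟩
          δ c (not κ) + (δ c κ + nbs T′ z g)                         ≡⟨ x∙yz≈y∙xz (δ c (not κ)) (δ c κ) _ ⟩
          δ c κ + (δ c (not κ) + nbs T′ z g)                         ≡⟨ cong₂ _+_ (term-self g _ l₁) (trans (nbs-∷ _ T′ z g) (cong (_+ nbs T′ z g) (term-self g _ l₂))) ⟨
          term g z (κ , e₁) + nbs ((not κ , e₂) ∷ T′) z g            ≡⟨ nbs-∷ _ _ z g ⟨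
          nbs (opposite-leaves κ e₁ e₂ T′) z g                       ≡⟨ nbs-↭ z g sp ⟨
          nbs Tʷ z g                                                 ∎
          where
          open ≡-Reasoning
          g : Bool → V → ℕ
          g k _ = δ c k

        p≢v : p ≢ v
        p≢v = proper l₁

        q≢v : q ≢ v
        q≢v = proper l₂

        before-p : ∀ c → cdeg Tʷ c p ≡ δ c κ + cdeg T′ c p
        before-p c = trans (before _ p≢v) (cong₂ (λ a b → a + (b + cdeg T′ c p)) (hit-≡ p _) (hit-≢ _ p≢q))

        after-p : ∀ c → cdeg T* c p ≡ δ c (not κ) + cdeg T′ c p
        after-p c = trans (after _ p≢v) (cong₂ (λ a b → a + (b + cdeg T′ c p)) (hit-≡ p _) (hit-≢ _ p≢q))

        before-q : ∀ c → cdeg Tʷ c q ≡ δ c (not κ) + cdeg T′ c q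
        before-q c = trans (before _ q≢v) (cong₂ (λ a b → a + (b + cdeg T′ c q)) (hit-≢ _ (p≢q ∘ sym)) (hit-≡ q _))

        after-q : ∀ c → cdeg T* c q ≡ δ c κ + cdeg T′ c q
        after-q c = trans (after _ q≢v) (cong₂ (λ a b → a + (b + cdeg T′ c q)) (hit-≢ _ (p≢q ∘ sym)) (hit-≡ q _))

        δκ̄κ̄ : δ (not κ) (not κ) ≡ 1
        δκ̄κ̄ = δ-same (not κ)

        δκ̄κ : δ (not κ) κ ≡ 0
        δκ̄κ = trans (cong (δ (not κ)) (sym (not-involutive κ))) (δ-opposite (not κ))

        ∷-same : ∀ {a b k} → k ≡ 1 → a ≡ k + b → a ≡ suc b
        ∷-same refl eq = eq

        ∷-opposite : ∀ {a b k} → k ≡ 0 → a ≡ k + b → a ≡ b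
        ∷-opposite refl eq = eq

        rest-p : cdeg T′ κ p ≡ 5 + cdeg T′ (not κ) p
        rest-p = suc-injective (trans (sym (∷-same (δ-same κ) (before-p κ)))
          (trans excess (cong (6 +_) (∷-opposite δκ̄κ (before-p (not κ))))))

        near-p : Near 5 T* p
        near-p = near-pair κ
          (subst₂ (λ a b → a ≤ 5 + b) (sym (∷-opposite (δ-opposite κ) (after-p κ))) (sym (∷-same δκ̄κ̄ (after-p (not κ))))
            (≤-trans (≤-reflexive rest-p) (+-monoʳ-≤ 5 (n≤1+n _))))
          (subst₂ (λ a b → a ≤ 5 + b) (sym (∷-same δκ̄κ̄ (after-p (not κ)))) (sym (∷-opposite (δ-opposite κ) (after-p κ)))
            (subst (λ a → suc (cdeg T′ (not κ) p) ≤ 5 + a) (sym rest-p) (s≤s (m≤n+m _ 9))))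

        balanced-off-q : ∀ z → z ≢ q → Near 5 T* z
        balanced-off-q z z≢q with z ≟ p
        ... | yes refl = near-p
        ... | no z≢p = near-cong {T′ = Tʷ} (λ c → same-degree c z≢p z≢q) (balanced z z≢p)

        near-q : Near 4 Tʷ q
        near-q = large-even colours Lq (balanced q (p≢q ∘ sym))

        before-q-κ : cdeg Tʷ κ q ≡ cdeg T′ κ q
        before-q-κ = ∷-opposite (δ-opposite κ) (before-q κ)

        before-q-κ̄ : cdeg Tʷ (not κ) q ≡ suc (cdeg T′ (not κ) q)
        before-q-κ̄ = ∷-same δκ̄κ̄ (before-q (not κ))

        after-q-κ : cdeg T* κ q ≡ suc (cdeg T′ κ q)
        after-q-κ = ∷-same (δ-same κ) (after-q κ)

        after-q-κ̄ : cdeg T* (not κ) q ≡ cdeg T′ (not κ) q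
        after-q-κ̄ = ∷-opposite δκ̄κ (after-q (not κ))

        -- A surplus of at most 3 at `q` becomes at most 5, so the excess is absorbed.
        settle : cdeg Tʷ κ q ≤ 3 + cdeg Tʷ (not κ) q → Balanceable vs es
        settle h = T* , C* , all
          where
          at-q : Near 5 T* q
          at-q = near-pair κ
            (subst₂ (λ a b → a ≤ 5 + b) (sym after-q-κ) (sym after-q-κ̄)
              (s≤s (subst₂ (λ a b → a ≤ 3 + b) before-q-κ before-q-κ̄ h)))
            (subst₂ (λ a b → a ≤ 5 + b) (sym after-q-κ̄) (sym after-q-κ)
              (≤-trans (n≤1+n _) (≤-trans (subst₂ (λ a b → a ≤ 4 + b) before-q-κ̄
                (trans (cong (λ k → cdeg Tʷ k q) (not-involutive κ)) before-q-κ) (near-q (not κ)))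
                (m≤n+m _ 2))))
          all : ∀ z → Near 5 T* z
          all z with z ≟ q
          ... | yes refl = at-q
          ... | no z≢q = balanced-off-q z z≢q

        -- By parity, the surplus of the large vertex `q` was at most 4. So it was exactly 4 and
        -- becomes exactly 6, the situation from which `p` started.
        moved : 4 + cdeg Tʷ (not κ) q ≤ cdeg Tʷ κ q → Token (insert R q) q
        moved h = record
          { colours = C*
          ; excess = trans after-q-κ (trans (cong suc (trans (sym before-q-κ)
              (trans (≤-antisym (near-q κ) h) (cong (4 +_) before-q-κ̄)))) (cong (6 +_) (sym after-q-κ̄)))
          ; balanced = balanced-off-q
          ; agree = agree*
          ; outside = λ z h c → let Rz , z≢q = insert-false R q h in
              trans (same-degree c (λ { refl → contradiction (trans (sym Rp) Rz) λ () }) z≢q) (outside z Rz c) }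
          where
          agree* : ∀ v′ → Mover v′ → (∀ g → nbs T* v′ g ≡ nbs T v′ g) ⊎ nbs T v′ (λ _ o → ⟦ isLarge o ∧ not (insert R q o) ⟧) ≡ 0
          agree* v′ m′ with v′ ≟ v
          ... | yes refl = inj₂ closed
          ... | no v′≢v with agree-lift R q {Tʷ} (agree v′ m′)
          ... | inj₁ h = inj₁ λ g → trans (unchanged g v′≢v (mover≢large m′ Lp) (mover≢large m′ Lq)) (h g)
          ... | inj₂ h = inj₂ h

        grown : 4 + cdeg Tʷ (not κ) q ≤ cdeg Tʷ κ q → Reached (insert R q)
        grown h = record
          { vertex = λ {z} i → at (λ z → z ∈ vs) (link-end (in-es colours (∈-resp-↭ (↭-sym sp) (there (here refl)))) l₂) vertex z i
          ; largeᴿ = λ {z} i → at Large Lq largeᴿ z i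
          ; disjoint = λ {z} i → at (λ z → S z ≡ false) Sq disjoint z i
          -- Before the exchange `q` lay outside `R`, so its surplus in the colouring of the token
          -- is its surplus in `T`.
          ; surplus = λ {z} i → at (λ z → 4 + cdeg T (not κ) z ≤ cdeg T κ z) (subst₂ (λ a b → 4 + a ≤ b) (outside q Rq (not κ)) (outside q Rq κ) h) surplus z i
          ; token = λ {z} i → at (Token (insert R q)) (moved h) (λ j → lift (token j)) z i }
          where
          at : ∀ (P : V → Set) → P q → (∀ {z} → R z ≡ true → P z) → ∀ z → insert R q z ≡ true → P z
          at P new old z i with z ≟ q
          ... | yes refl = new
          ... | no z≢q = old (trans (sym (∨-identityʳ (R z))) i)

      bounded : ∀ {a x c} → a ≤ 1 → c ≤ 1 → a * (x * c) ≤ x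
      bounded {a} {x} {c} h h′ = begin
        a * (x * c)   ≤⟨ *-mono-≤ h (*-monoʳ-≤ x h′) ⟩
        1 * (x * 1)   ≡⟨ trans (*-identityˡ _) (*-identityʳ x) ⟩
        x             ∎
        where open ≤-Reasoning

      -- The edges of colour `k` from `v` to large vertices equal to `p` are counted by `g`. The
      -- count is 1 in `T`, hence also in `Tʷ`, where `flex-count` reduces it to the indicator of
      -- `p′` being `p`.
      same-end : ∀ {Tʷ v k} → Colouring vs es Tʷ → Mover v → (∀ g → nbs Tʷ v g ≡ nbs T v g) →
        (F : Flex T k v) (F′ : Flex Tʷ k v) → Flex.p F′ ≡ Flex.p F
      same-end {Tʷ} {v} {k} C′ m h F F′ = dec-sound (p′ ≟ p) (≤-reflexive (sym (trans (sym found′) (trans (h g) found))))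
        where
        open Flex F using (p; q; large-p)
        open Flex F′ using () renaming (p to p′; q to q′; large-p to large-p′)
        g : Bool → V → ℕ
        g c o = δ k c * (⟦ isLarge o ⟧ * ⟦ does (o ≟ p) ⟧)
        g≤ : ∀ c o → g c o ≤ ⟦ isLarge o ⟧
        g≤ c o = bounded (δ≤1 k c) (⟦⟧≤1 (does (o ≟ p)))
        value : ∀ {o} o′ → Large o → g k o + g (not k) o′ ≡ ⟦ does (o ≟ p) ⟧
        value {o} o′ Lo = begin
          g k o + g (not k) o′                          ≡⟨ cong₂ _+_ (cong₂ (λ a b → a * (b * ⟦ does (o ≟ p) ⟧)) (δ-same k) (large-one Lo))
                                                                    (cong (_* (⟦ isLarge o′ ⟧ * ⟦ does (o′ ≟ p) ⟧)) (δ-opposite k)) ⟩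
          1 * (1 * ⟦ does (o ≟ p) ⟧) + 0                ≡⟨ arith ⟦ does (o ≟ p) ⟧ ⟩
          ⟦ does (o ≟ p) ⟧                              ∎
          where
          open ≡-Reasoning
          arith : ∀ x → 1 * (1 * x) + 0 ≡ x
          arith = solve-∀
        found : nbs T v g ≡ 1
        found = trans (flex-count C m F g g≤) (trans (value q large-p) (dec-complete (p ≟ p) refl))
        found′ : nbs Tʷ v g ≡ ⟦ does (p′ ≟ p) ⟧
        found′ = trans (flex-count C′ m F′ g g≤) (value q′ large-p′)

      opaque
        -- As `q` is a large neighbour of `v` outside `R`, `agree` shows that the token at `p` lives
        -- in a colouring where `v` still has its edges coloured as in `T`. So an exchange at `v` in
        -- that colouring again leads from `p` to `q`.
        escape : ∀ {R v} → Reached R → v ∈ vs → Mover v → (F : Flex T κ v) →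
          R (Flex.p F) ≡ true → R (Flex.q F) ≡ false → S (Flex.q F) ≡ false → Balanceable vs es ⊎ Reached (insert R (Flex.q F))
        escape {R} {v} D v∈ m F Rp Rq Sq = go (agree v m)
          where
          open Flex F using (p; q; large-p; large-q)
          t : Token R p
          t = Reached.token D Rp
          open Token t
          leaving : (Bool → Bool) → V → ℕ
          leaving f o = ⟦ isLarge o ∧ f (R o) ⟧
          ∧-bound : ∀ a b → ⟦ a ∧ b ⟧ ≤ ⟦ a ⟧
          ∧-bound true b = ⟦⟧≤1 b
          ∧-bound false b = z≤n
          closed : nbs T v (λ _ o → ⟦ isLarge o ∧ not (insert R q o) ⟧) ≡ 0
          closed = trans (flex-count C m F _ λ _ o → ∧-bound (isLarge o) _)
            (cong₂ _+_ (trans (∧-large _ large-p) (cong (⟦_⟧ ∘ not) (insert-⊇ R q {p} Rp)))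
                       (trans (∧-large _ large-q) (cong (⟦_⟧ ∘ not) (insert-new R q))))
          at-q : nbs T v (λ _ o → ⟦ isLarge o ∧ not (R o) ⟧) ≡ ⟦ isLarge p ∧ not (R p) ⟧ + 1
          at-q = trans (flex-count C m F _ λ _ o → ∧-bound (isLarge o) _)
            (cong (⟦ isLarge p ∧ not (R p) ⟧ +_) (trans (∧-large _ large-q) (cong (⟦_⟧ ∘ not) Rq)))
          result : ∀ {p′ q′ e₁ e₂ T′} → p′ ≡ p → q′ ≡ q → Tʷ ↭ opposite-leaves κ e₁ e₂ T′ → Link e₁ v p′ → Link e₂ v q′ →
            Colouring vs es ((not κ , e₁) ∷ (κ , e₂) ∷ T′) → Balanceable vs es ⊎ Reached (insert R q)
          result refl refl sp l₁ l₂ C* = choose (4 + cdeg Tʷ (not κ) q ≤? cdeg Tʷ κ q)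
            where
            open Move D Rp Rq Sq v∈ m t sp l₁ l₂ large-p large-q C* closed
            choose : Dec (4 + cdeg Tʷ (not κ) q ≤ cdeg Tʷ κ q) → Balanceable vs es ⊎ Reached (insert R q)
            choose (yes h) = inj₂ (grown h)
            choose (no h) = inj₁ (settle (≤-pred (≰⇒> h)))
          go : (∀ g → nbs Tʷ v g ≡ nbs T v g) ⊎ nbs T v (λ _ o → ⟦ isLarge o ∧ not (R o) ⟧) ≡ 0 → Balanceable vs es ⊎ Reached (insert R q)
          go (inj₂ h) = contradiction (trans (sym (trans at-q (+-comm _ 1))) h) λ ()
          go (inj₁ h) with flexM colours v∈ m
          ... | inj₁ b = inj₁ b
          ... | inj₂ flexes = result (same-end colours m h F (flexes κ)) (same-end colours m h (flex-opposite F) (flex-opposite (flexes κ)))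
                (Flex.split (flexes κ)) (Flex.l₁ (flexes κ)) (Flex.l₂ (flexes κ)) (Flex.flipped (flexes κ))

      Closed : (V → Bool) → V → Set
      Closed R v = Mover v → ∃[ F ] (R (Flex.p {T} {κ} {v} F) ≡ true → R (Flex.q F) ≡ true ⊎ S (Flex.q F) ≡ true)

      module Close {R : V → Bool} (D : Reached R) (closed : ∀ {v} → v ∈ vs → Closed R v) where

        open Reached D

        S∪R : V → Bool
        S∪R v = S v ∨ R v

        apart : ∀ v → ¬ (S v ≡ true × R v ≡ true)
        apart v (s , r) = contradiction (trans (sym s) (disjoint r)) λ ()

        -- The edges of colour c between R and the movers, listed at their ends in R, resp. at the movers.
        outer inner : Bool → V → Bool → V → ℕ
        outer c u k o = ⟦ R u ⟧ * (δ c k * ⟦ isMover o ⟧)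
        inner c v k o = ⟦ R o ⟧ * (δ c k * ⟦ isMover v ⟧)

        count : ((V → ℕ) → ℕ)
        count = ∑ vs

        transfer : ∀ c → count (λ u → nbs T u (outer c u)) ≡ count (λ v → nbs T v (inner c v))
        transfer c = swap-count T (unique wf) (λ i → ends wf (∈-resp-↭ (edges C) i)) (outer c)

        -- The surplus of 4, restricted to edges to movers: the other edges of colour `κ` number at
        -- most `ρ u`, and those of the opposite colour are dropped.
        at-R : ∀ u → ⟦ R u ⟧ * 4 + nbs T u (outer (not κ) u) ≤ nbs T u (outer κ u) + ⟦ R u ⟧ * ρ u
        at-R u with R u in eq
        ... | false = ≤-trans (≤-reflexive (nbs-zero T u (λ _ _ → refl))) z≤n
        ... | true = begin
          4 + nbs T u (λ k o → 1 * (δ (not κ) k * ⟦ isMover o ⟧))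
            ≤⟨ +-monoʳ-≤ 4 (nbs-mono T u λ k o → ≤-trans (≤-reflexive (*-identityˡ _)) (≤-trans (*-monoʳ-≤ (δ (not κ) k) (⟦⟧≤1 (isMover o))) (≤-reflexive (*-identityʳ _)))) ⟩
          4 + cdeg T (not κ) u
            ≤⟨ surplus eq ⟩
          cdeg T κ u
            ≤⟨ nbs-mono T u (λ k o → dominate (δ κ k) (isMover o) (δ≤1 κ k)) ⟩
          nbs T u (λ k o → 1 * (δ κ k * ⟦ isMover o ⟧) + ⟦ not (isMover o) ⟧)
            ≡⟨ nbs-+ T u _ _ ⟩
          nbs T u (λ k o → 1 * (δ κ k * ⟦ isMover o ⟧)) + nbs T u (λ _ o → ⟦ not (isMover o) ⟧)
            ≡⟨ cong (nbs T u (λ k o → 1 * (δ κ k * ⟦ isMover o ⟧)) +_) (trans (nbs≡usum C u _) (sym (*-identityˡ _))) ⟩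
          nbs T u (λ k o → 1 * (δ κ k * ⟦ isMover o ⟧)) + 1 * ρ u ∎
          where
          open ≤-Reasoning
          dominate : ∀ d b → d ≤ 1 → d ≤ 1 * (d * ⟦ b ⟧) + ⟦ not b ⟧
          dominate d true _ = ≤-reflexive (arith d)
            where
            arith : ∀ d → d ≡ 1 * (d * 1) + 0
            arith = solve-∀
          dominate d false h = ≤-trans h (m≤n+m 1 _)

        -- A mover whose end of colour `κ` is in `R` has its other end in `R`, which balances it, or
        -- in `S`; in the latter case it is cut by `S` but not by the union. This is the case
        -- analysis of `boundary`.
        at-mover : ∀ {v} → v ∈ vs → nbs T v (inner κ v) + cut S∪R v ≤ nbs T v (inner (not κ) v) + cut S v
        at-mover {v} v∈ = go (mover? v) refl
          where
          go : (d : Dec (Mover v)) → mover? v ≡ d → nbs T v (inner κ v) + cut S∪R v ≤ nbs T v (inner (not κ) v) + cut S v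
          go (no n) eq = ≤-trans (≤-reflexive (cong₂ _+_ (nbs-zero T v (λ k o → none k o)) (cong (_* one? (usum es v (λ o → ⟦ S∪R o ⟧))) zero-mover))) z≤n
            where
            zero-mover : ⟦ isMover v ⟧ ≡ 0
            zero-mover = dec-refute (mover? v) n
            none : ∀ k o → inner κ v k o ≡ 0
            none k o = trans (cong (λ x → ⟦ R o ⟧ * (δ κ k * x)) zero-mover) (trans (cong (⟦ R o ⟧ *_) (*-zeroʳ (δ κ k))) (*-zeroʳ ⟦ R o ⟧))
          go (yes m) eq = go′ (closed v∈ m)
            where
            go′ : ∃[ F ] (R (Flex.p {T} {κ} {v} F) ≡ true → R (Flex.q F) ≡ true ⊎ S (Flex.q F) ≡ true) →
              nbs T v (inner κ v) + cut S∪R v ≤ nbs T v (inner (not κ) v) + cut S v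
            go′ (F , cl) = subst₂ _≤_ (sym left) (sym right)
              (boundary (S p) (R p) (S q) (R q) (apart p) (apart q) cl)
              where
              open Flex F using (p; q)
              mover-one : ⟦ isMover v ⟧ ≡ 1
              mover-one = dec-complete (mover? v) m
              within : ∀ (X : V → Bool) → (∀ {o} → X o ≡ true → Large o) → ∀ o → ⟦ X o ⟧ ≤ ⟦ isLarge o ⟧
              within X h o with X o in e
              ... | false = z≤n
              ... | true = ≤-reflexive (sym (large-one (h e)))
              inner-value : ∀ c → nbs T v (inner c v) ≡ ⟦ R p ⟧ * (δ c κ * 1) + ⟦ R q ⟧ * (δ c (not κ) * 1)
              inner-value c = trans (nbs-cong T v λ k o → cong (λ x → ⟦ R o ⟧ * (δ c k * x)) mover-one)
                (flex-count C m F _ λ k o → ≤-trans (*-monoʳ-≤ ⟦ R o ⟧ (≤-trans (≤-reflexive (*-identityʳ _)) (δ≤1 c k)))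
                  (≤-trans (≤-reflexive (*-identityʳ _)) (within R largeᴿ o)))
              cut-value : ∀ (X : V → Bool) → (∀ {o} → X o ≡ true → Large o) → cut X v ≡ one? (⟦ X p ⟧ + ⟦ X q ⟧)
              cut-value X h = trans (cong₂ (λ a b → a * one? b) mover-one
                (trans (sym (nbs≡usum C v _)) (flex-count C m F _ λ _ o → within X h o))) (*-identityˡ _)
              union-large : ∀ {o} → S∪R o ≡ true → Large o
              union-large {o} h with S o in e
              ... | true = large e
              ... | false = largeᴿ h
              left : nbs T v (inner κ v) + cut S∪R v ≡ ⟦ R p ⟧ + one? (⟦ S∪R p ⟧ + ⟦ S∪R q ⟧)
              left = cong₂ _+_ (trans (inner-value κ) (trans (cong₂ (λ a b → ⟦ R p ⟧ * (a * 1) + ⟦ R q ⟧ * (b * 1)) (δ-same κ) (δ-opposite κ))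
                (arith ⟦ R p ⟧ ⟦ R q ⟧))) (cut-value S∪R union-large)
                where
                arith : ∀ x y → x * 1 + y * 0 ≡ x
                arith = solve-∀
              right : nbs T v (inner (not κ) v) + cut S v ≡ ⟦ R q ⟧ + one? (⟦ S p ⟧ + ⟦ S q ⟧)
              right = cong₂ _+_ (trans (inner-value (not κ)) (trans (cong₂ (λ a b → ⟦ R p ⟧ * (a * 1) + ⟦ R q ⟧ * (b * 1)) δκ̄κ (δ-same (not κ)))
                (arith ⟦ R p ⟧ ⟦ R q ⟧))) (cut-value S large)
                where
                δκ̄κ : δ (not κ) κ ≡ 0
                δκ̄κ = trans (cong (δ (not κ)) (sym (not-involutive κ))) (δ-opposite (not κ))
                arith : ∀ x y → x * 0 + y * 1 ≡ y
                arith = solve-∀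

        union-sum : ∀ (f : V → ℕ) → count (λ v → ⟦ S∪R v ⟧ * f v) ≡ count (λ v → ⟦ S v ⟧ * f v) + count (λ v → ⟦ R v ⟧ * f v)
        union-sum f = trans (∑-cong vs λ {v} _ → trans (cong (_* f v) (⟦∨⟧ (S v) (R v) (apart v))) (*-distribʳ-+ (f v) ⟦ S v ⟧ ⟦ R v ⟧))
                            (∑-+ vs _ _)

        union-size : count (λ v → ⟦ S∪R v ⟧) ≡ count (λ v → ⟦ S v ⟧) + count (λ v → ⟦ R v ⟧)
        union-size = trans (∑-cong vs λ {v} _ → ⟦∨⟧ (S v) (R v) (apart v)) (∑-+ vs _ _)

        combine : ∀ {s r cs ρs ρr a b c} → 4 * s + cs ≤ ρs → r * 4 + b ≤ a + ρr → a + c ≤ b + cs → 4 * (s + r) + c ≤ ρs + ρr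
        combine {s} {r} {cs} {ρs} {ρr} {a} {b} {c} h₁ h₂ h₃ = +-cancelʳ-≤ (cs + b + a) _ _
          (subst₂ _≤_ (lhs s r cs a b c) (rhs cs ρs ρr a b) (+-mono-≤ h₁ (+-mono-≤ h₂ h₃)))
          where
          lhs : ∀ s r cs a b c → (4 * s + cs) + ((r * 4 + b) + (a + c)) ≡ (4 * (s + r) + c) + (cs + b + a)
          lhs = solve-∀
          rhs : ∀ cs ρs ρr a b → ρs + ((a + ρr) + (b + cs)) ≡ (ρs + ρr) + (cs + b + a)
          rhs = solve-∀

        sum-R : count (λ v → ⟦ R v ⟧) * 4 + count (λ v → nbs T v (inner (not κ) v)) ≤
                count (λ v → nbs T v (inner κ v)) + count (λ v → ⟦ R v ⟧ * ρ v)
        sum-R = subst₂ _≤_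
          (trans (∑-+ vs _ _) (cong₂ _+_ (∑-*ʳ vs 4 _) (transfer (not κ))))
          (trans (∑-+ vs _ _) (cong (_+ count (λ v → ⟦ R v ⟧ * ρ v)) (transfer κ)))
          (∑-mono vs λ {u} _ → at-R u)

        sum-movers : count (λ v → nbs T v (inner κ v)) + count (cut S∪R) ≤ count (λ v → nbs T v (inner (not κ) v)) + count (cut S)
        sum-movers = subst₂ _≤_ (∑-+ vs _ _) (∑-+ vs _ _) (∑-mono vs at-mover)

        opaque
          saturated : Saturated S∪R
          saturated = record
            { large = λ {v} h → pick v h (S v) refl
            ; dense = subst₂ _≤_ (cong (λ x → 4 * x + count (cut S∪R)) (sym union-size)) (sym (union-sum ρ))
                (combine {s = count (λ v → ⟦ S v ⟧)} {r = count (λ v → ⟦ R v ⟧)} dense sum-R sum-movers) }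
            where
            pick : ∀ v → S∪R v ≡ true → ∀ b → S v ≡ b → Large v
            pick v h true e = large e
            pick v h false e = largeᴿ (trans (sym (cong (_∨ R v) e)) h)

      ∨-introʳ : ∀ a {b} → b ≡ true → a ∨ b ≡ true
      ∨-introʳ true _ = refl
      ∨-introʳ false h = h

      -- `n` bounds the number of vertices outside `R`. A mover leading from `R` to a vertex outside
      -- both `R` and `S` either absorbs the excess or enlarges `R`; if there is none, `R` is closed
      -- and joins `S`.
      grow : ∀ n {R u} → ∑ vs (λ v → ⟦ not (R v) ⟧) ≤ n → Reached R → R u ≡ true → Outcome u
      grow n {R} {u} bound D Ru = finish (scan vs check)
        where
        check : ∀ {v} → v ∈ vs → Outcome u ⊎ Closed R v
        check {v} v∈ with mover? v
        ... | no ¬m = inj₂ λ m → contradiction m ¬m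
        ... | yes m with flexM C v∈ m
        ... | inj₁ b = inj₁ (inj₁ b)
        ... | inj₂ flexes = look (R p) refl (R q) refl (S q) refl
          where
          F : Flex T κ v
          F = flexes κ
          open Flex F using (p; q; l₂; split)
          continue : ∀ n → ∑ vs (λ v → ⟦ not (R v) ⟧) ≤ n → R q ≡ false → Reached (insert R q) → Outcome u
          continue n bound Rq D′ with count-shrinks vs (Reached.vertex D′ (insert-new R q)) (λ z → insert-⊇ R q {z}) Rq (insert-new R q)
          continue zero bound Rq D′ | lt with () ← ≤-trans lt bound
          continue (suc n) bound Rq D′ | lt = grow n (≤-pred (≤-trans lt bound)) D′ (insert-⊇ R q {u} Ru)
          look : ∀ a → R p ≡ a → ∀ b → R q ≡ b → ∀ c → S q ≡ c → Outcome u ⊎ Closed R v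
          look true Rp false Rq false Sq with escape D v∈ m F Rp Rq Sq
          ... | inj₁ b = inj₁ (inj₁ b)
          ... | inj₂ D′ = inj₁ (continue n bound Rq D′)
          look false Rp _ _ _ _ = inj₂ λ _ → F , λ h → contradiction (trans (sym h) Rp) λ ()
          look true _ true Rq _ _ = inj₂ λ _ → F , λ _ → inj₁ Rq
          look true _ false _ true Sq = inj₂ λ _ → F , λ _ → inj₂ Sq
        finish : Outcome u ⊎ (∀ {v} → v ∈ vs → Closed R v) → Outcome u
        finish (inj₁ o) = o
        finish (inj₂ closed) = inj₂ (S∪R , saturated , (λ v h → cong (_∨ R v) h) , ∨-introʳ (S u) Ru)
          where open Close D closed

-- Discharging and the induction.

module Counting {V : Set} (_≟_ : DecidableEquality V) where

  open Coloured _≟_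
  open Link
  open Reductions _≟_
  open Colouring
  open WellFormed
  open LeafPairs _≟_
  open Tokens _≟_

  -- The charge that a small vertex of degree d with k large neighbours receives from each of them.
  gift : ℕ → ℕ → ℕ
  gift 2 _ = 6
  gift 3 2 = 3
  gift 3 _ = 2
  gift _ _ = 0

  gift≤6 : ∀ d k → gift d k ≤ 6
  gift≤6 0 k = z≤n
  gift≤6 1 k = z≤n
  gift≤6 2 k = ≤-refl
  gift≤6 3 0 = m≤m+n 2 4
  gift≤6 3 1 = m≤m+n 2 4
  gift≤6 3 2 = m≤m+n 3 3
  gift≤6 3 (suc (suc (suc k))) = m≤m+n 2 4
  gift≤6 (suc (suc (suc (suc d)))) k = z≤n

  gift-big : ∀ {d k} → 8 ≤ d → gift d k ≡ 0
  gift-big (s≤s (s≤s (s≤s (s≤s _)))) = refl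

  module Solve {vs : List V} {es : List (V × V)} (wf : WellFormed vs es)
    (other : ∀ x → ∃[ w ] (w ∈ vs × w ≢ x))
    (ih : ∀ {vs′ es′} → length vs′ < length vs → WellFormed vs′ es′ → ∃[ T ] Colouring vs′ es′ T → Balanceable vs′ es′)
    {T : Coloured} (C : Colouring vs es T)
    where
    open Instance wf other ih
    open Spread wf other ih

    leaf : V → ℕ
    leaf = leaf? wf other ih

    leaves : V → ℕ
    leaves u = usum es u leaf

    Progress : (V → Bool) → V → Set
    Progress S u = Balanceable vs es ⊎ ∃[ S′ ] (Saturated S′ × (∀ v → S v ≡ true → S′ v ≡ true) × S′ u ≡ true)

    start : ∀ {S u T} → Saturated S → Colouring vs es T → u ∈ vs → Large u → S u ≡ false →
      (∀ v → v ≢ u → Near 5 T v) → ∀ κ → cdeg T κ u ≡ 6 + cdeg T (not κ) u → Progress S u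
    start {S} {u} {T} sat CT u∈ Lu Su h κ ex = grow _ ≤-refl reached (dec-true (u ≟ u) refl)
      where
      open Excess sat CT κ
      R : V → Bool
      R z = does (z ≟ u)
      initial : Token R u
      initial = record { colours = CT ; excess = ex ; balanced = h ; agree = λ _ _ → inj₁ λ _ → refl ; outside = λ _ _ _ → refl }
      at : ∀ (P : V → Set) → P u → ∀ z → R z ≡ true → P z
      at P new z i with z ≟ u
      ... | yes refl = new
      reached : Reached R
      reached = record
        { vertex = λ {z} → at (_∈ vs) u∈ z ; largeᴿ = λ {z} → at Large Lu z ; disjoint = λ {z} → at (λ z → S z ≡ false) Su z
        ; surplus = λ {z} → at (λ z → 4 + cdeg T (not κ) z ≤ cdeg T κ z) (≤-trans (+-monoˡ-≤ (cdeg T (not κ) u) (m≤m+n 4 2)) (≤-reflexive (sym ex))) z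
        ; token = λ {z} → at (Token R) initial z }

    opaque
      progress : ∀ {S u} → Saturated S → u ∈ vs → Large u → S u ≡ false → 1 ≤ leaves u → Progress S u
      progress {S} {u} sat u∈ Lu Su pos =
        let c , e , x , i , l , d = leaf-neighbour wf other ih {T} Lu (subst (1 ≤_) (sym (nbs≡usum C u leaf)) pos)
            x∈ = link-end (in-es C i) (link-sym l)
            e₁ , y , T′ , p , l₁ , free = degree-two-at (spans C) x∈ u∈ (proper l) (trans (nbs≡usum C x _) d) i l
            T⁺ , C⁺ , h , h₆ , _ = reduce₂ x∈ C p l l₁ free d
        in decide C⁺ h h₆ (cdeg T⁺ true u ≤? 5 + cdeg T⁺ false u) (cdeg T⁺ false u ≤? 5 + cdeg T⁺ true u)
        where
        decide : ∀ {T⁺} → Colouring vs es T⁺ → (∀ v → v ≢ u → Near 5 T⁺ v) → Near 6 T⁺ u →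
          Dec (cdeg T⁺ true u ≤ 5 + cdeg T⁺ false u) → Dec (cdeg T⁺ false u ≤ 5 + cdeg T⁺ true u) → Progress S u
        decide C⁺ h h₆ (no n) _ = start sat C⁺ u∈ Lu Su h true (≤-antisym (h₆ true) (≰⇒> n))
        decide C⁺ h h₆ (yes _) (no n) = start sat C⁺ u∈ Lu Su h false (≤-antisym (h₆ false) (≰⇒> n))
        decide {T⁺} C⁺ h h₆ (yes y) (yes y′) = inj₁ (T⁺ , C⁺ , all)
          where
          all : ∀ v → Near 5 T⁺ v
          all v with v ≟ u
          ... | no v≢u = h v v≢u
          ... | yes refl = λ { true → y ; false → y′ }

    record Reduced : Set where
      field
        at-two : ∀ {v} → v ∈ vs → deg v ≡ 2 → largeNbs v ≡ 2
        at-three : ∀ {v} → v ∈ vs → deg v ≡ 3 → 2 ≤ largeNbs v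
        one-leaf : ∀ {u} → u ∈ vs → Large u → leaves u ≤ 1

    largeNbs≤deg : ∀ v → largeNbs v ≤ deg v
    largeNbs≤deg v = subst₂ _≤_ (nbs≡usum C v _) (nbs≡usum C v _) (nbs-mono T v λ _ o → ⟦⟧≤1 (isLarge o))

    two≤largeNbs : ∀ {v} → Flex T true v → 2 ≤ largeNbs v
    two≤largeNbs {v} F = subst (2 ≤_) (trans (sym (trans (nbs-split F _)
        (cong₂ (λ a b → a + (b + nbs T′ v (λ _ o → ⟦ isLarge o ⟧))) (large-one large-p) (large-one large-q)))) (nbs≡usum C v _)) (m≤m+n 2 _)
      where open Flex F

    reduced : Balanceable vs es ⊎ Reduced
    reduced = go (scan vs two) (scan vs three) (scan vs leafy)
      where
      two : ∀ {v} → v ∈ vs → Balanceable vs es ⊎ (deg v ≡ 2 → largeNbs v ≡ 2)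
      two {v} v∈ with deg v ≟ⁿ 2
      ... | no n = inj₂ λ d → contradiction d n
      ... | yes d with flex₂ C v∈ d
      ... | inj₁ b = inj₁ b
      ... | inj₂ F = inj₂ λ _ → ≤-antisym (≤-trans (largeNbs≤deg v) (≤-reflexive d)) (two≤largeNbs (F true))
      three : ∀ {v} → v ∈ vs → Balanceable vs es ⊎ (deg v ≡ 3 → 2 ≤ largeNbs v)
      three {v} v∈ with deg v ≟ⁿ 3
      ... | no n = inj₂ λ d → contradiction d n
      ... | yes d with flex₃ C v∈ d
      ... | inj₁ b = inj₁ b
      ... | inj₂ F = inj₂ λ _ → two≤largeNbs (F true)
      leafy : ∀ {u} → u ∈ vs → Balanceable vs es ⊎ (Large u → leaves u ≤ 1)
      leafy {u} u∈ with large? u | leaves u ≤? 1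
      ... | no n | _ = inj₂ λ L → contradiction L n
      ... | yes L | yes h = inj₂ λ _ → h
      ... | yes L | no h = inj₁ (two-leaves wf other ih C L (≰⇒> h))
      go : Balanceable vs es ⊎ (∀ {v} → v ∈ vs → deg v ≡ 2 → largeNbs v ≡ 2) →
           Balanceable vs es ⊎ (∀ {v} → v ∈ vs → deg v ≡ 3 → 2 ≤ largeNbs v) →
           Balanceable vs es ⊎ (∀ {u} → u ∈ vs → Large u → leaves u ≤ 1) → Balanceable vs es ⊎ Reduced
      go (inj₁ b) _ _ = inj₁ b
      go (inj₂ _) (inj₁ b) _ = inj₁ b
      go (inj₂ _) (inj₂ _) (inj₁ b) = inj₁ b
      go (inj₂ h₂) (inj₂ h₃) (inj₂ h₁) = inj₂ record { at-two = h₂ ; at-three = h₃ ; one-leaf = h₁ }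

    module Discharge (red : Reduced) {S : V → Bool} (sat : Saturated S)
      (full : ∀ {u} → u ∈ vs → Large u → 1 ≤ leaves u → S u ≡ true) where

      open Reduced red
      open Saturated sat

      τ : V → ℕ
      τ v = gift (deg v) (largeNbs v)

      -- The charge of an edge at its end v: 6, corrected by the gift along the edge.
      weight : ℕ → ℕ → ℕ → ℕ → ℕ
      weight lv lo tv to = (6 + lo * tv) ∸ lv * to

      w : V → V → ℕ
      w v o = weight ⟦ isLarge v ⟧ ⟦ isLarge o ⟧ (τ v) (τ o)

      large-zero : ∀ {v} → ¬ Large v → ⟦ isLarge v ⟧ ≡ 0
      large-zero {v} = dec-refute (large? v)

      Profile : ℕ → ℕ → Set
      Profile l t = (l ≡ 1 × t ≡ 0) ⊎ (l ≡ 0 × t ≤ 6)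

      profile : ∀ v → Profile ⟦ isLarge v ⟧ (τ v)
      profile v = go (large? v)
        where
        go : Dec (Large v) → Profile ⟦ isLarge v ⟧ (τ v)
        go (yes L) = inj₁ (large-one L , gift-big {deg v} {largeNbs v} (proj₁ L))
        go (no n) = inj₂ (large-zero n , gift≤6 (deg v) (largeNbs v))

      -- Gifts are at most 6, so the truncated subtraction is exact, and what one end of an edge
      -- gives is what the other receives.
      weight-sum : ∀ {lv lo tv to} → Profile lv tv → Profile lo to → weight lv lo tv to + weight lo lv to tv ≡ 12
      weight-sum (inj₁ (refl , refl)) (inj₁ (refl , refl)) = refl
      weight-sum {to = t} (inj₁ (refl , refl)) (inj₂ (refl , h)) = meet h
        where
        meet : ∀ {t} → t ≤ 6 → (6 ∸ (1 * t)) + (6 + 1 * t) ≡ 12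
        meet {t} h rewrite *-identityˡ t = trans (x+6+y (6 ∸ t) t) (cong (6 +_) (m∸n+n≡m h))
          where
          x+6+y : ∀ x y → x + (6 + y) ≡ 6 + (x + y)
          x+6+y = solve-∀
      weight-sum {tv = t} (inj₂ (refl , h)) (inj₁ (refl , refl)) = meet h
        where
        meet : ∀ {t} → t ≤ 6 → (6 + 1 * t) + (6 ∸ (1 * t)) ≡ 12
        meet {t} h rewrite *-identityˡ t = trans (6+y+x (6 ∸ t) t) (cong (6 +_) (m∸n+n≡m h))
          where
          6+y+x : ∀ x y → (6 + y) + x ≡ 6 + (x + y)
          6+y+x = solve-∀
      weight-sum (inj₂ (refl , _)) (inj₂ (refl , _)) = refl

      total : ∑ vs (λ v → nbs T v (λ _ → w v)) ≡ length T * 12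
      total = trans (double-count T (unique wf) (λ i → ends wf (∈-resp-↭ (edges C) i)) (λ v _ → w v))
        (trans (∑-cong T λ {e} _ → weight-sum (profile (proj₁ (proj₂ e))) (profile (proj₂ (proj₂ e)))) (∑-const T 12))

      -- Of the 6 on an edge, a large vertex keeps 0 towards degree 2, 3 towards a mover of degree
      -- 3, 4 towards other vertices of degree 3, and 6 else. The last summand is a loan of 3 for
      -- each neighbour of degree 2.
      charge-bound : ∀ d k → 3 + ⟦ not (does ((d ≟ⁿ 2) ⊎-dec ((d ≟ⁿ 3) ×-dec (k ≟ⁿ 2)))) ⟧ ≤
        (6 ∸ gift d k) + (⟦ does (d ≟ⁿ 2) ⟧ + (⟦ does (d ≟ⁿ 2) ⟧ + ⟦ does (d ≟ⁿ 2) ⟧))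
      charge-bound 0 k = m≤m+n 4 2
      charge-bound 1 k = m≤m+n 4 2
      charge-bound 2 k = ≤-refl
      charge-bound 3 0 = ≤-refl
      charge-bound 3 1 = ≤-refl
      charge-bound 3 2 = ≤-refl
      charge-bound 3 (suc (suc (suc k))) = ≤-refl
      charge-bound (suc (suc (suc (suc d)))) k = m≤m+n 4 2

      -- The gifts are made for this: 2·6 + 2·6 and 3·6 + 2·3 are 24, and 3·6 + k·2 is at least 24
      -- for k at least 3. From degree 4 on no gift is required.
      small-bound : ∀ d k → 2 ≤ d → (d ≡ 2 → k ≡ 2) → (d ≡ 3 → 2 ≤ k) → 24 ≤ d * 6 + k * gift d k
      small-bound (suc zero) k (s≤s ()) _ _
      small-bound 2 k _ h _ with refl ← h refl = ≤-refl
      small-bound 3 0 _ _ h with () ← h refl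
      small-bound 3 1 _ _ h with s≤s () ← h refl
      small-bound 3 2 _ _ _ = ≤-refl
      small-bound 3 (suc (suc (suc k))) _ _ _ = m≤m+n 24 (k * 2)
      small-bound (suc (suc (suc (suc d)))) k _ _ _ = ≤-trans (m≤m+n 24 (d * 6)) (m≤m+n _ (k * 0))

      deg≥2 : ∀ {v} → v ∈ vs → 2 ≤ deg v
      deg≥2 {v} v∈ = subst (2 ≤_) (cdeg-sum C true v) (+-mono-≤ (colour-present C v∈ true) (colour-present C v∈ false))

      at-large : ∀ {v} → Large v → deg v * 3 + ρ v ≤ nbs T v (λ _ → w v) + (leaves v + (leaves v + leaves v))
      at-large {v} L = subst₂ _≤_ lhs rhs (nbs-mono T v λ _ o → ≤-trans (charge-bound (deg o) (largeNbs o))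
          (≤-reflexive (cong (_+ (leaf o + (leaf o + leaf o))) (sym (value o)))))
        where
        value : ∀ o → w v o ≡ 6 ∸ τ o
        value o = trans (cong₂ (λ a b → weight a ⟦ isLarge o ⟧ b (τ o)) (large-one L) (gift-big {deg v} {largeNbs v} (proj₁ L)))
          (cong₂ (λ a b → (6 + a) ∸ b) (*-zeroʳ ⟦ isLarge o ⟧) (*-identityˡ (τ o)))
        lhs : nbs T v (λ _ o → one true o * 3 + ⟦ not (isMover o) ⟧) ≡ deg v * 3 + ρ v
        lhs = trans (nbs-+ T v _ _) (cong₂ _+_ (trans (nbs-*ʳ T v one 3) (cong (_* 3) (nbs≡usum C v _))) (nbs≡usum C v _))
        rhs : nbs T v (λ _ o → w v o + (leaf o + (leaf o + leaf o))) ≡ nbs T v (λ _ → w v) + (leaves v + (leaves v + leaves v))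
        rhs = trans (nbs-+ T v _ _) (cong (nbs T v (λ _ → w v) +_) (trans (nbs-+ T v _ _) (cong₂ _+_ (nbs≡usum C v _)
          (trans (nbs-+ T v _ _) (cong₂ _+_ (nbs≡usum C v _) (nbs≡usum C v _))))))

      at-small : ∀ {v} → ¬ Large v → nbs T v (λ _ → w v) ≡ deg v * 6 + largeNbs v * τ v
      at-small {v} n = trans (nbs-cong T v λ _ o → cong (λ a → weight a ⟦ isLarge o ⟧ (τ v) (τ o)) (large-zero n))
        (trans (nbs-+ T v (λ _ _ → 6) (λ _ o → ⟦ isLarge o ⟧ * τ v)) (cong₂ _+_
          (trans (nbs-*ʳ T v one 6) (cong (_* 6) (nbs≡usum C v _)))
          (trans (nbs-*ʳ T v (λ _ o → ⟦ isLarge o ⟧) (τ v)) (cong (_* τ v) (nbs≡usum C v _)))))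

      at-vertex : ∀ {v} → v ∈ vs → 24 + ⟦ S v ⟧ * ρ v ≤ nbs T v (λ _ → w v) + ⟦ S v ⟧ * 4
      at-vertex {v} v∈ = go (large? v) (S v) refl
        where
        go : Dec (Large v) → ∀ b → S v ≡ b → 24 + ⟦ b ⟧ * ρ v ≤ nbs T v (λ _ → w v) + ⟦ b ⟧ * 4
        go (no n) true Sv = contradiction (large Sv) n
        go (no n) false _ = subst (24 ≤_) (trans (sym (at-small n)) (sym (+-identityʳ _)))
          (small-bound (deg v) (largeNbs v) (deg≥2 v∈) (at-two v∈) (at-three v∈))
        go (yes L) true _ = begin
          24 + 1 * ρ v                                                ≡⟨ cong (24 +_) (*-identityˡ (ρ v)) ⟩
          -- Large degree gives 8·3 = 24.
          24 + ρ v                                                    ≤⟨ +-monoˡ-≤ (ρ v) (*-monoˡ-≤ 3 (proj₁ L)) ⟩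
          deg v * 3 + ρ v                                             ≤⟨ at-large L ⟩
          -- The single possible leaf costs 3, within the allowance of 4 for a vertex of `S`.
          nbs T v (λ _ → w v) + (leaves v + (leaves v + leaves v))    ≤⟨ +-monoʳ-≤ (nbs T v (λ _ → w v)) (≤-trans (+-mono-≤ ℓ (+-mono-≤ ℓ ℓ)) (m≤m+n 3 1)) ⟩
          nbs T v (λ _ → w v) + 4                                     ∎
          where
          open ≤-Reasoning
          ℓ : leaves v ≤ 1
          ℓ = one-leaf v∈ L
        go (yes L) false Sv = begin
          24                                                          ≤⟨ *-monoˡ-≤ 3 (proj₁ L) ⟩
          deg v * 3                                                   ≤⟨ m≤m+n _ (ρ v) ⟩
          deg v * 3 + ρ v                                             ≤⟨ at-large L ⟩
          nbs T v (λ _ → w v) + (leaves v + (leaves v + leaves v))    ≡⟨ cong (λ x → nbs T v (λ _ → w v) + (x + (x + x))) none ⟩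
          nbs T v (λ _ → w v) + 0                                     ∎
          where
          open ≤-Reasoning
          none : leaves v ≡ 0
          none with leaves v in eq
          ... | zero = refl
          ... | suc _ = contradiction (trans (sym (full v∈ L (subst (1 ≤_) (sym eq) (s≤s z≤n)))) Sv) λ ()

      -- Summed over all vertices, 24|V| plus the sum of `ρ` over `S` is at most 12|E| + 4|S|.
      -- Saturation cancels the terms of `S`, and 24|V| ≤ 12|E| contradicts |E| + 2 ≤ 2|V|.
      impossible : ⊥
      impossible = clash (length T) (length vs) sizes (subst₂ _≤_
          (trans (∑-+ vs _ _) (cong (_+ ∑ vs (λ v → ⟦ S v ⟧ * ρ v)) (∑-const vs 24)))
          (trans (∑-+ vs _ _) (cong₂ _+_ total (trans (∑-*ʳ vs 4 (λ v → ⟦ S v ⟧)) (*-comm (∑ vs (λ v → ⟦ S v ⟧)) 4))))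
          (∑-mono vs at-vertex)) (≤-trans (m≤m+n _ _) dense)
        where
        sizes : length T + 2 ≤ 2 * length vs
        sizes = subst (λ a → a + 2 ≤ 2 * length vs) (trans (sym (↭-length (edges C))) (length-map proj₂ T)) (size wf)
        clash : ∀ t n {a b} → t + 2 ≤ 2 * n → n * 24 + a ≤ t * 12 + b → b ≤ a → ⊥
        clash t n {a} {b} h₁ h₂ h₃ = m+1+n≰m (t * 12 + b) (≤-trans (subst (_≤ n * 24 + a) (lhs t b)
          (+-mono-≤ (subst ((t + 2) * 12 ≤_) (rhs n) (*-monoˡ-≤ 12 h₁)) h₃)) h₂)
          where
          lhs : ∀ t b → (t + 2) * 12 + b ≡ t * 12 + b + 24
          lhs = solve-∀
          rhs : ∀ n → 2 * n * 12 ≡ n * 24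
          rhs = solve-∀

    -- `n` bounds the number of vertices outside `S`. A large vertex outside `S` with a neighbour of
    -- degree 2 either yields a balanced colouring or gets into a larger saturated set.
    loop : Reduced → ∀ n {S} → ∑ vs (λ v → ⟦ not (S v) ⟧) ≤ n → Saturated S → Balanceable vs es
    loop red n {S} bound sat = finish (scan vs check)
      where
      check : ∀ {u} → u ∈ vs → Balanceable vs es ⊎ (Large u → 1 ≤ leaves u → S u ≡ true)
      check {u} u∈ = look (S u) refl (large? u) (1 ≤? leaves u)
        where
        next : ∀ n → ∑ vs (λ v → ⟦ not (S v) ⟧) ≤ n → S u ≡ false → Progress S u → Balanceable vs es
        next n bound Su (inj₁ b) = b
        next n bound Su (inj₂ (S′ , sat′ , ⊇ , S′u)) with count-shrinks vs {S} {S′} u∈ ⊇ Su S′u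
        next zero bound Su (inj₂ (S′ , sat′ , ⊇ , S′u)) | lt with () ← ≤-trans lt bound
        next (suc n) bound Su (inj₂ (S′ , sat′ , ⊇ , S′u)) | lt = loop red n (≤-pred (≤-trans lt bound)) sat′
        look : ∀ b → S u ≡ b → Dec (Large u) → Dec (1 ≤ leaves u) → Balanceable vs es ⊎ (Large u → 1 ≤ leaves u → S u ≡ true)
        look true Su _ _ = inj₂ λ _ _ → Su
        look false Su (no n) _ = inj₂ λ L → contradiction L n
        look false Su (yes _) (no n) = inj₂ λ _ h → contradiction h n
        look false Su (yes L) (yes h) = inj₁ (next n bound Su (progress sat u∈ L Su h))
      finish : Balanceable vs es ⊎ (∀ {u} → u ∈ vs → Large u → 1 ≤ leaves u → S u ≡ true) → Balanceable vs es
      finish (inj₁ b) = b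
      finish (inj₂ full) = ⊥-elim (Discharge.impossible red sat full)

    empty-saturated : Saturated (λ _ → false)
    empty-saturated = record { large = λ () ; dense = ≤-reflexive (trans (cong₂ (λ a b → 4 * a + b) (∑-zero vs) cuts) (sym (∑-zero vs))) }
      where
      cuts : ∑ vs (cut (λ _ → false)) ≡ 0
      cuts = trans (∑-cong vs λ {v} _ → trans (cong (λ a → ⟦ isMover v ⟧ * one? a) (trans (sym (nbs≡usum C v _)) (nbs-zero T v λ _ _ → refl)))
        (*-zeroʳ ⟦ isMover v ⟧)) (∑-zero vs)

    opaque
      solve-instance : Balanceable vs es
      solve-instance = go reduced
        where
        go : Balanceable vs es ⊎ Reduced → Balanceable vs es
        go (inj₁ b) = b
        go (inj₂ red) = loop red _ ≤-refl empty-saturated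

  two-vertices : ∀ {a b : V} {vs} → Unique (a ∷ b ∷ vs) → ∀ x → ∃[ w ] (w ∈ a ∷ b ∷ vs × w ≢ x)
  two-vertices {a} {b} ((a≢b ∷ _) ∷ _) x with a ≟ x
  ... | no a≢x = a , here refl , a≢x
  ... | yes refl = b , there (here refl) , a≢b ∘ sym

  -- Induction on a bound for |V|. The bound on |E| excludes an empty vertex list and leaves no
  -- edges at a single vertex.
  balance : ∀ n {vs es} → length vs ≤ n → WellFormed vs es → ∃[ T ] Colouring vs es T → Balanceable vs es
  balance n {[]} {es} bound wf (T , C) = contradiction (≤-trans (m≤n+m 2 (length es)) (size wf)) λ ()
  balance n {_ ∷ []} {[]} bound wf (T , C) = T , C , λ v c →
    subst (λ a → a ≤ 5 + cdeg T (not c) v) (sym (none T (edges C) v c)) z≤n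
    where
    none : ∀ T → map proj₂ T ↭ [] → ∀ v c → cdeg T c v ≡ 0
    none [] _ v c = nbs-[] v _
    none (_ ∷ T) p v c with () ← ↭-length p
  balance n {_ ∷ []} {e ∷ es} bound wf (T , C) with s≤s () ← ≤-trans (m≤n+m 2 (length es)) (≤-pred (size wf))
  balance (suc n) {vs@(_ ∷ _ ∷ _)} bound wf (T , C) =
    Solve.solve-instance wf (two-vertices (unique wf)) (λ lt → balance n (≤-pred (≤-trans lt bound))) C

-- Numbers of edges of connected graphs and forests.

module Sizes {V : Set} (_≟_ : DecidableEquality V) where

  open Coloured _≟_
  open Link

  Pairs : Set
  Pairs = List (V × V)

  Linked : Pairs → V → V → Set
  Linked es = EqClosure (λ a b → (a , b) ∈ es)

  linked-map : ∀ {es es′} (f : V → V) → (∀ {a b} → (a , b) ∈ es → Linked es′ (f a) (f b)) →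
               ∀ {a b} → Linked es a b → Linked es′ (f a) (f b)
  linked-map f h = Eq.gfold (Eq.isEquivalence _) f h

  linked-sym : ∀ {es a b} → Linked es a b → Linked es b a
  linked-sym = Eq.symmetric _

  there-linked : ∀ {e es a b} → Linked es a b → Linked (e ∷ es) a b
  there-linked = linked-map id (Eq.return ∘ there)

  contract : V → V → V × V → V × V
  contract a b (p , q) = redirect b a p , redirect b a q

  redirect-target : ∀ b a → redirect b a a ≡ a
  redirect-target b a with a ≟ b
  ... | yes _ = refl
  ... | no _ = refl

  equal-length : ∀ {vs : List V} → Unique vs → (∀ {a b} → a ∈ vs → b ∈ vs → a ≡ b) → length vs ≤ 1
  equal-length {[]} _ _ = z≤n
  equal-length {_ ∷ []} _ _ = ≤-refl
  equal-length {_ ∷ _ ∷ _} ((n ∷ _) ∷ _) h = contradiction (h (here refl) (there (here refl))) n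

  length-∖-≤ : ∀ {vs} b → Unique vs → length vs ≤ suc (length (vs ∖ b))
  length-∖-≤ {vs} b un with Any.any? (b ≟_) vs
  ... | yes i = ≤-reflexive (length-∖ un i)
  ... | no n = m≤n⇒m≤1+n (≤-reflexive (cong length (sym (filter-all _ (All.tabulate λ i eq → n (subst (_∈ vs) eq i))))))

  -- Contracting an edge keeps `vs` connected and removes at most one vertex. Links may run outside
  -- `vs`, so the removed end `b` need not belong to it.
  connected-size : ∀ k {vs} es → length es ≡ k → Unique vs → (∀ {a b} → a ∈ vs → b ∈ vs → Linked es a b) → length vs ≤ suc k
  connected-size zero [] refl un h = equal-length un λ i j → Eq.gfold isEquivalence id (λ ()) (h i j)
  connected-size (suc k) {vs} ((a , b) ∷ es) eq un h = ≤-trans (length-∖-≤ b un)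
    (s≤s (connected-size k (map (contract a b) es) (trans (length-map (contract a b) es) (suc-injective eq)) (unique-∖ un) joined))
    where
    image : ∀ {p q} → (p , q) ∈ (a , b) ∷ es → Linked (map (contract a b) es) (redirect b a p) (redirect b a q)
    image (here refl) = subst₂ (Linked _) (sym (redirect-target b a)) (sym (redirect-≡ b a)) ε
    image (there i) = Eq.return (∈-map⁺ (contract a b) i)
    joined : ∀ {x y} → x ∈ vs ∖ b → y ∈ vs ∖ b → Linked (map (contract a b) es) x y
    joined x∈ y∈ = let x∈vs , x≢b = ∈-∖⁻ {vs} x∈ ; y∈vs , y≢b = ∈-∖⁻ {vs} y∈ in
      subst₂ (Linked _) (redirect-≢ a x≢b) (redirect-≢ a y≢b) (linked-map (redirect b a) image (h x∈vs y∈vs))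

  -- Acyclicity as a construction order: every added edge joins two vertices that were not yet
  -- linked.
  data Forest : Pairs → Set where
    [] : Forest []
    _∷_ : ∀ {a b es} → ¬ Linked es a b → Forest es → Forest ((a , b) ∷ es)

  -- Repeated passages of the first edge can be short-cut, so one passage, in one of the two
  -- directions, is enough.
  through-edge : ∀ {a b es p q} → Linked ((a , b) ∷ es) p q →
    Linked es p q ⊎ (Linked es p a × Linked es b q) ⊎ (Linked es p b × Linked es a q)
  through-edge ε = inj₁ ε
  through-edge (fwd (here refl) ◅ r) with through-edge r
  ... | inj₁ k = inj₂ (inj₁ (ε , k))
  ... | inj₂ (inj₁ (k , l)) = inj₁ (linked-sym k ◅◅ l)
  ... | inj₂ (inj₂ (_ , l)) = inj₁ l
  through-edge (bwd (here refl) ◅ r) with through-edge r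
  ... | inj₁ k = inj₂ (inj₂ (ε , k))
  ... | inj₂ (inj₁ (_ , l)) = inj₁ l
  ... | inj₂ (inj₂ (k , l)) = inj₁ (linked-sym k ◅◅ l)
  through-edge (fwd (there i) ◅ r) with through-edge r
  ... | inj₁ k = inj₁ (fwd i ◅ k)
  ... | inj₂ (inj₁ (k , l)) = inj₂ (inj₁ (fwd i ◅ k , l))
  ... | inj₂ (inj₂ (k , l)) = inj₂ (inj₂ (fwd i ◅ k , l))
  through-edge (bwd (there i) ◅ r) with through-edge r
  ... | inj₁ k = inj₁ (bwd i ◅ k)
  ... | inj₂ (inj₁ (k , l)) = inj₂ (inj₁ (bwd i ◅ k , l))
  ... | inj₂ (inj₂ (k , l)) = inj₂ (inj₂ (bwd i ◅ k , l))

  uncontract : ∀ {a b es p q} → Linked (map (contract a b) es) (redirect b a p) (redirect b a q) → Linked ((a , b) ∷ es) p q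
  uncontract {a} {b} {es} {p} {q} k = to p ◅◅ linked-map id lifted k ◅◅ linked-sym (to q)
    where
    to : ∀ x → Linked ((a , b) ∷ es) x (redirect b a x)
    to x with x ≟ b
    ... | yes refl = bwd (here refl) ◅ ε
    ... | no _ = ε
    lifted : ∀ {x y} → (x , y) ∈ map (contract a b) es → Linked ((a , b) ∷ es) x y
    lifted i with ∈-map⁻ (contract a b) i
    ... | (x , y) , j , refl = linked-sym (to x) ◅◅ (fwd (there j) ◅ to y)

  -- If contraction linked the ends of a further edge `pq`, the lifted walk would use `ab`. Its two
  -- remaining pieces and `pq` would then link `a` and `b` without the edge `ab`.
  contract-forest : ∀ {a b es} → ¬ Linked es a b → Forest es → Forest (map (contract a b) es)
  contract-forest n [] = []
  contract-forest {a} {b} n (_∷_ {p} {q} {es} h f) = separate ∷ contract-forest (n ∘ there-linked) f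
    where
    separate : ¬ Linked (map (contract a b) es) (redirect b a p) (redirect b a q)
    separate k with through-edge (uncontract {a} {b} {es} {p} {q} k)
    ... | inj₁ l = h l
    ... | inj₂ (inj₁ (pa , bq)) = n (there-linked (linked-sym pa) ◅◅ (fwd (here refl) ◅ there-linked (linked-sym bq)))
    ... | inj₂ (inj₂ (pb , aq)) = n (there-linked aq ◅◅ (bwd (here refl) ◅ there-linked pb))

  forest-size : ∀ k {vs} es → length es ≡ k → Unique vs → Ends vs es → 1 ≤ length vs → Forest es → suc k ≤ length vs
  forest-size zero [] refl un ends h f = h
  forest-size (suc k) {vs} ((a , b) ∷ es) eq un ends h (n ∷ f) = subst (suc (suc k) ≤_) (sym (length-∖ un b∈))
    (s≤s (forest-size k (map (contract a b) es) (trans (length-map (contract a b) es) (suc-injective eq)) (unique-∖ un) ends′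
      (nonempty (∈-∖⁺ a∈ a≢b)) (contract-forest n f)))
    where
    a∈ = proj₁ (ends (here refl))
    b∈ = proj₂ (ends (here refl))
    a≢b : a ≢ b
    a≢b refl = n ε
    nonempty : ∀ {x} {xs : List V} → x ∈ xs → 1 ≤ length xs
    nonempty (here _) = s≤s z≤n
    nonempty (there _) = s≤s z≤n
    stays : ∀ {x} → x ∈ vs → redirect b a x ∈ vs ∖ b
    stays {x} x∈ with x ≟ b
    ... | yes refl = ∈-∖⁺ a∈ a≢b
    ... | no x≢b = ∈-∖⁺ x∈ x≢b
    ends′ : Ends (vs ∖ b) (map (contract a b) es)
    ends′ i with ∈-map⁻ (contract a b) i
    ... | (x , y) , j , refl = stays (proj₁ (ends (there j))) , stays (proj₂ (ends (there j)))

  class : Bool → Coloured → Pairs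
  class c [] = []
  class c ((k , e) ∷ T) = if does (c ≟ᵇ k) then e ∷ class c T else class c T

  ∈-class : ∀ {c e T} → (c , e) ∈ T → e ∈ class c T
  ∈-class {true} (here refl) = here refl
  ∈-class {false} (here refl) = here refl
  ∈-class {c} {T = (k , _) ∷ _} (there i) with does (c ≟ᵇ k)
  ... | true = there (∈-class i)
  ... | false = ∈-class i

  class-lengths : ∀ T → length (class true T) + length (class false T) ≡ length T
  class-lengths [] = refl
  class-lengths ((true , e) ∷ T) = cong suc (class-lengths T)
  class-lengths ((false , e) ∷ T) = trans (+-suc _ _) (cong suc (class-lengths T))

  spanning-size : ∀ {vs T} → Unique vs → Spanning vs T → 2 * length vs ≤ length T + 2
  spanning-size {vs} {T} un s = begin
    2 * length vs                                               ≡⟨ cong (length vs +_) (+-identityʳ _) ⟩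
    length vs + length vs                                       ≤⟨ +-mono-≤ (bound true) (bound false) ⟩
    suc (length (class true T)) + suc (length (class false T))  ≡⟨ arith (length (class true T)) _ ⟩
    length (class true T) + length (class false T) + 2          ≡⟨ cong (_+ 2) (class-lengths T) ⟩
    length T + 2                                                ∎
    where
    open ≤-Reasoning
    arith : ∀ a b → suc a + suc b ≡ a + b + 2
    arith = solve-∀
    bound : ∀ c → length vs ≤ suc (length (class c T))
    bound c = connected-size _ (class c T) refl un λ i j → Eq.map ∈-class (s c i j)

-- Translation between graphs and coloured edge lists.

module Conversion (G : Graph) where

  open Coloured (Fin._≟_ {n G})
  open Link
  open Sizes (Fin._≟_ {n G})
  open Reductions (Fin._≟_ {n G})
  open Colouring
  open Counting (Fin._≟_ {n G}) using (balance)

  -- As in `Walk`, the vertex list omits the last vertex, hence the separate condition `u ≢ v`.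
  data Simple (P : Edge G → Set) : Vertex G → Vertex G → List (Edge G) → List (Vertex G) → Set where
    stop : ∀ {u} → Simple P u u [] []
    step : ∀ {u w v es vs} e → P e → Joins G e u w → ¬ u ∈ vs → u ≢ v → Simple P w v es vs → Simple P u v (e ∷ es) (u ∷ vs)

  module _ {P : Edge G → Set} where

    suffix : ∀ {u v x es vs} → Simple P u v es vs → x ∈ vs → ∃[ es′ ] ∃[ vs′ ] Simple P x v es′ vs′
    suffix s@(step _ _ _ _ _ _) (here refl) = _ , _ , s
    suffix (step _ _ _ _ _ s) (there i) = suffix s i

    prepend : ∀ {e u w v es vs} → P e → Joins G e u w → Simple P w v es vs → ∃[ es′ ] ∃[ vs′ ] Simple P u v es′ vs′
    prepend {u = u} {v = v} {vs = vs} pe j s with u Fin.≟ v | Any.any? (u Fin.≟_) vs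
    ... | yes refl | _ = _ , _ , stop
    ... | no _ | yes i = suffix s i
    ... | no u≢v | no u∉ = _ , _ , step _ pe j u∉ u≢v s

    start∈ : ∀ {u v es vs} → Simple P u v es vs → u ∈ vs ⊎ u ≡ v
    start∈ stop = inj₂ refl
    start∈ (step _ _ _ _ _ _) = inj₁ (here refl)

    touches : ∀ {u v es vs e x y} → Simple P u v es vs → e ∈ es → Joins G e x y → x ∈ vs ⊎ x ≡ v
    touches (step _ _ (inj₁ (refl , refl)) _ _ s) (here refl) (inj₁ (refl , refl)) = inj₁ (here refl)
    touches (step _ _ (inj₂ (refl , refl)) _ _ s) (here refl) (inj₂ (refl , refl)) = inj₁ (here refl)
    touches (step _ _ (inj₁ (refl , refl)) _ _ s) (here refl) (inj₂ (refl , refl)) = tail (start∈ s)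
      where
      tail : ∀ {w u v : Vertex G} {vs} → w ∈ vs ⊎ w ≡ v → w ∈ u ∷ vs ⊎ w ≡ v
      tail (inj₁ i) = inj₁ (there i)
      tail (inj₂ h) = inj₂ h
    touches (step _ _ (inj₂ (refl , refl)) _ _ s) (here refl) (inj₁ (refl , refl)) = tail (start∈ s)
      where
      tail : ∀ {w u v : Vertex G} {vs} → w ∈ vs ⊎ w ≡ v → w ∈ u ∷ vs ⊎ w ≡ v
      tail (inj₁ i) = inj₁ (there i)
      tail (inj₂ h) = inj₂ h
    touches (step _ _ _ _ _ s) (there i) j with touches s i j
    ... | inj₁ k = inj₁ (there k)
    ... | inj₂ h = inj₂ h

    simple-walk : ∀ {S u v es vs} → (∀ {e} → P e → S e ≡ true) → Simple P u v es vs → Walk G S u v es vs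
    simple-walk h stop = stop
    simple-walk h (step e pe j _ _ s) = step e (h pe) j (simple-walk h s)

    simple-edges : ∀ {u v es vs} → Simple P u v es vs → All P es
    simple-edges stop = []
    simple-edges (step _ pe _ _ _ s) = pe ∷ simple-edges s

    unique-edges : ∀ {u v es vs} → Simple P u v es vs → Unique es
    unique-edges stop = []
    unique-edges (step e _ j u∉ u≢v s) = All.tabulate (λ { i refl → fresh (touches s i j) }) ∷ unique-edges s
      where
      fresh : ¬ (_ ∈ _ ⊎ _ ≡ _)
      fresh (inj₁ i) = u∉ i
      fresh (inj₂ h) = u≢v h

    unique-vertices : ∀ {u v es vs} → Simple P u v es vs → Unique (v ∷ vs)
    unique-vertices stop = [] ∷ []
    unique-vertices (step _ _ _ u∉ u≢v s) with unique-vertices s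
    ... | v∉ ∷ un = ((u≢v ∘ sym) ∷ v∉) ∷ (All.tabulate (λ { i refl → u∉ i }) ∷ un)

  linked-simple : ∀ {fs u v} → Linked (map (ends G) fs) u v → ∃[ es ] ∃[ vs ] Simple (_∈ fs) u v es vs
  linked-simple ε = _ , _ , stop
  linked-simple (fwd i ◅ p) with ∈-map⁻ (ends G) i
  ... | e , e∈ , refl = prepend e∈ (inj₁ (refl , refl)) (proj₂ (proj₂ (linked-simple p)))
  linked-simple (bwd i ◅ p) with ∈-map⁻ (ends G) i
  ... | e , e∈ , refl = prepend e∈ (inj₂ (refl , refl)) (proj₂ (proj₂ (linked-simple p)))

  -- A link between the ends of `e` through the other edges shortens to a simple path, which `e`
  -- closes to a cycle.
  acyclic-forest : ∀ {S} → Acyclic G S → ∀ fs → Unique fs → (∀ {e} → e ∈ fs → S e ≡ true) → Forest (map (ends G) fs)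
  acyclic-forest acyclic [] _ _ = []
  acyclic-forest acyclic (e ∷ fs) (e∉ ∷ un) h = open-edge ∷ acyclic-forest acyclic fs un (h ∘ there)
    where
    open-edge : ¬ Linked (map (ends G) fs) (proj₁ (ends G e)) (proj₂ (ends G e))
    open-edge k = let es , vs , s = linked-simple k in
      acyclic (_ , e , es , _ , step e (h (here refl)) (inj₂ (refl , refl)) (simple-walk (h ∘ there) s)
              , (All.map (All.lookup e∉) (simple-edges s) ∷ unique-edges s) , unique-vertices s)

  vertices : List (Vertex G)
  vertices = allFin (n G)

  paint : EdgeSet G → Coloured
  paint S = tabulate (λ e → S e , ends G e)

  colour-class : Bool → EdgeSet G → EdgeSet G
  colour-class true S = S
  colour-class false S e = not (S e)

  class-sound : ∀ c {S e} → colour-class c S e ≡ true → S e ≡ c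
  class-sound true h = h
  class-sound false {S} {e} h = trans (sym (not-involutive (S e))) (cong not h)

  class-complete : ∀ S e → colour-class (S e) S e ≡ true
  class-complete S e with S e in eq
  ... | true = eq
  ... | false = cong not eq

  walk-linked : ∀ {S T c u v es vs} → (∀ {e} → e ∈ es → S e ≡ true → (c , ends G e) ∈ T) → Walk G S u v es vs → Con T c u v
  walk-linked h stop = ε
  walk-linked h (step e Se (inj₁ (refl , refl)) w) = fwd (h (here refl) Se) ◅ walk-linked (h ∘ there) w
  walk-linked h (step e Se (inj₂ (refl , refl)) w) = bwd (h (here refl) Se) ◅ walk-linked (h ∘ there) w

  painted : ∀ {S c e} → S e ≡ c → (c , ends G e) ∈ paint S
  painted {e = e} refl = ∈-tabulate⁺ e

  paint-spanning : ∀ {S} → (∀ c → Connected G (colour-class c S)) → Spanning vertices (paint S)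
  paint-spanning {S} con c {a} {b} _ _ = walk-linked (λ _ h → painted (class-sound c h)) (proj₂ (proj₂ (con c a b)))

  con-walk : ∀ {S c u v} → Con (paint S) c u v → ∃[ es ] ∃[ vs ] Walk G (colour-class c S) u v es vs
  con-walk ε = _ , _ , stop
  con-walk {S} (fwd i ◅ p) with ∈-tabulate⁻ i
  ... | e , refl = _ , _ , step e (class-complete S e) (inj₁ (refl , refl)) (proj₂ (proj₂ (con-walk p)))
  con-walk {S} (bwd i ◅ p) with ∈-tabulate⁻ i
  ... | e , refl = _ , _ , step e (class-complete S e) (inj₂ (refl , refl)) (proj₂ (proj₂ (con-walk p)))

  filter-lengths : ∀ (S : A → Bool) xs → length (filter (λ x → S x ≟ᵇ true) xs) + length (filter (λ x → S x ≟ᵇ false) xs) ≡ length xs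
  filter-lengths S [] = refl
  filter-lengths S (x ∷ xs) with S x
  ... | true = cong suc (filter-lengths S xs)
  ... | false = trans (+-suc _ _) (cong suc (filter-lengths S xs))

  acyclic-size : ∀ {S} → 1 ≤ n G → (∀ c → Acyclic G (colour-class c S)) → m G + 2 ≤ 2 * n G
  acyclic-size {S} pos acyclic = begin
    m G + 2                                  ≡⟨ cong (_+ 2) (sym (trans (filter-lengths S (allFin (m G))) (length-tabulate id))) ⟩
    length (fs true) + length (fs false) + 2 ≡⟨ arith (length (fs true)) _ ⟩
    suc (length (fs true)) + suc (length (fs false)) ≤⟨ +-mono-≤ (bound true) (bound false) ⟩
    n G + n G                                ≡⟨ cong (n G +_) (+-identityʳ _) ⟨
    2 * n G                                  ∎
    where
    open ≤-Reasoning
    arith : ∀ a b → a + b + 2 ≡ suc a + suc b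
    arith = solve-∀
    fs : Bool → List (Edge G)
    fs c = filter (λ e → S e ≟ᵇ c) (allFin (m G))
    bound : ∀ c → suc (length (fs c)) ≤ n G
    bound c = subst (suc (length (fs c)) ≤_) (length-tabulate id) (forest-size _ (map (ends G) (fs c)) (length-map (ends G) (fs c))
      (Unique.allFin⁺ (n G)) (λ _ → ∈-allFin _ , ∈-allFin _) (subst (1 ≤_) (sym (length-tabulate id)) pos)
      (acyclic-forest (acyclic c) (fs c) (Unique.filter⁺ _ (Unique.allFin⁺ (m G))) λ i →
        let eq = proj₂ (∈-filter⁻ (λ e → S e ≟ᵇ c) {xs = allFin (m G)} i) in subst (λ k → colour-class k S _ ≡ true) eq (class-complete S _)))

  -- A cycle edge could be dropped without disconnecting its class, leaving too few edges.
  spanning-acyclic : ∀ {S} → m G + 2 ≤ 2 * n G → Spanning vertices (paint S) → ∀ c → Acyclic G (colour-class c S)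
  spanning-acyclic {S} size s c (u , e , es , _ , step .e Se j w , (e∉ ∷ _) , _) =
    <-irrefl refl (≤-trans (s≤s size) (≤-trans (s≤s (subst (λ k → 2 * k ≤ length T′ + 2) (length-tabulate {n = n G} id) (spanning-size (Unique.allFin⁺ (n G)) s′)))
      (+-monoˡ-≤ 2 fewer-edges)))
    where
    others : List (Edge G)
    others = filter (λ e′ → ¬? (e′ Fin.≟ e)) (allFin (m G))
    T′ : Coloured
    T′ = map (λ e′ → S e′ , ends G e′) others
    fewer-edges : length T′ < m G
    fewer-edges = subst₂ _<_ (sym (length-map _ others)) (length-tabulate id)
      (filter-notAll (λ e′ → ¬? (e′ Fin.≟ e)) (allFin (m G)) (Any.map (λ { refl n → n refl }) (∈-allFin e)))
    kept : ∀ {e′} → e′ ≢ e → (S e′ , ends G e′) ∈ T′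
    kept {e′} n = ∈-map⁺ _ (∈-filter⁺ (λ e′ → ¬? (e′ Fin.≟ e)) (∈-allFin e′) n)
    detour : Con T′ c _ u
    detour = walk-linked (λ {e′} i h → subst (λ k → (k , ends G e′) ∈ T′) (class-sound c h) (kept λ { refl → All.lookup e∉ i refl })) w
    across : ∀ {x y} → Joins G e x y → Con T′ c y x → Con T′ c (proj₁ (ends G e)) (proj₂ (ends G e))
    across (inj₁ (refl , refl)) k = con-sym k
    across (inj₂ (refl , refl)) k = k
    bridge : Con T′ c (proj₁ (ends G e)) (proj₂ (ends G e))
    bridge = across j detour
    s′ : Spanning vertices T′
    s′ k a∈ b∈ = con-⊆ replace (s k a∈ b∈)
      where
      replace : ∀ {a b} → (k , a , b) ∈ paint S → Con T′ k a b
      replace i with ∈-tabulate⁻ i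
      ... | e′ , refl with e′ Fin.≟ e
      ... | no n = edge (kept n)
      ... | yes refl = subst (λ k → Con T′ k _ _) (sym (class-sound c Se)) bridge

  -- Restores the identity of edges: once the coloured list is permuted so that its pairs stand in
  -- the order of `ends`, the position of an entry names its edge.
  decode : ∀ {k} (f : Fin k → Vertex G × Vertex G) (T : Coloured) → map proj₂ T ≡ tabulate f →
           Σ (Fin k → Bool) λ S → T ≡ tabulate (λ e → S e , f e)
  decode {zero} f [] eq = (λ ()) , refl
  decode {suc k} f ((c , e) ∷ T) eq with ∷-injective eq
  ... | refl , eq′ with decode (f ∘ suc) T eq′
  ... | S , refl = (λ { zero → c ; (suc i) → S i }) , refl

  no-loops : ∀ {S e} → Acyclic G S → S e ≡ true → proj₁ (ends G e) ≢ proj₂ (ends G e)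
  no-loops {e = e} acyclic Se eq = acyclic (_ , e , [] , _ , step e Se (inj₁ (refl , sym eq)) stop , [] ∷ [] , [] ∷ [])

  -- A loop counts once in `degree` but twice in `nbs`, so the two agree only where colour `c` has
  -- no loops.
  degree-nbs : ∀ {k} c (S : Fin k → Bool) (f : Fin k → Vertex G × Vertex G) v →
    (∀ e → S e ≡ c → proj₁ (f e) ≢ proj₂ (f e)) → (B : Fin k → Bool) → (∀ e → ⟦ B e ⟧ ≡ δ c (S e)) →
    countFin (λ e → B e ∧ (does (proj₁ (f e) Fin.≟ v) ∨ does (proj₂ (f e) Fin.≟ v))) ≡ cdeg (tabulate (λ e → S e , f e)) c v
  degree-nbs {zero} c S f v _ B _ = sym (nbs-[] v _)
  degree-nbs {suc k} c S f v loopless B h = trans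
    (cong₂ _+_ (head (S zero) (f zero) (B zero) (loopless zero) (h zero)) (degree-nbs c (S ∘ suc) (f ∘ suc) v (loopless ∘ suc) (B ∘ suc) (h ∘ suc)))
    (sym (nbs-∷ _ _ v _))
    where
    head : ∀ s e b → (s ≡ c → proj₁ e ≢ proj₂ e) → ⟦ b ⟧ ≡ δ c s →
      ⟦ b ∧ (does (proj₁ e Fin.≟ v) ∨ does (proj₂ e Fin.≟ v)) ⟧ ≡ term (λ k _ → δ c k) v (s , e)
    head s (p , q) b ne eq with p Fin.≟ v | q Fin.≟ v
    ... | no p≢v | no q≢v = trans (cong ⟦_⟧ (∧-zeroʳ b)) (sym (cong₂ _+_ (hit-≢ _ (p≢v ∘ sym)) (hit-≢ _ (q≢v ∘ sym))))
    ... | yes refl | no q≢v = trans (cong ⟦_⟧ (∧-identityʳ b)) (trans eq (trans (sym (+-identityʳ _)) (sym (cong₂ _+_ (hit-≡ v _) (hit-≢ _ (q≢v ∘ sym))))))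
    ... | no p≢v | yes refl = trans (cong ⟦_⟧ (∧-identityʳ b)) (trans eq (sym (cong₂ _+_ (hit-≢ _ (p≢v ∘ sym)) (hit-≡ v _))))
    ... | yes refl | yes refl = trans (cong ⟦_⟧ (∧-identityʳ b)) (trans eq (trans none (sym (trans (cong₂ _+_ (hit-≡ v _) (hit-≡ v _)) (cong₂ _+_ none none)))))
      where
      none : δ c s ≡ 0
      none = absent c s ne
        where
        absent : ∀ c s → (s ≡ c → v ≢ v) → δ c s ≡ 0
        absent true true n = contradiction refl (n refl)
        absent true false n = refl
        absent false true n = refl
        absent false false n = contradiction refl (n refl)

  class-indicator : ∀ c S e → ⟦ colour-class c S e ⟧ ≡ δ c (S e)
  class-indicator true S e = refl
  class-indicator false S e = refl

  close : ∀ {a b} → a ≤ 5 + b → b ≤ 5 + a → ∣ a - b ∣ ≤ 5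
  close {a} {b} h h′ with ≤-total a b
  ... | inj₁ a≤b = ≤-trans (≤-reflexive (m≤n⇒∣m-n∣≡n∸m a≤b)) (m≤n+o⇒m∸n≤o b a (subst (b ≤_) (+-comm 5 a) h′))
  ... | inj₂ b≤a = ≤-trans (≤-reflexive (m≤n⇒∣n-m∣≡n∸m b≤a)) (m≤n+o⇒m∸n≤o a b (subst (a ≤_) (+-comm 5 b) h))

  balanced-factorization : 1 ≤ n G → ∀ S → (∀ c → SpanningTree G (colour-class c S)) →
    ∃[ S′ ] ((∀ c → SpanningTree G (colour-class c S′)) ×
      (∀ v → ∣ degree G S′ v - degree G (colour-class false S′) v ∣ ≤ 5))
  balanced-factorization pos S trees = finish (balance _ ≤-refl wf (paint S , colouring ↭-refl (paint-spanning (proj₁ ∘ trees))))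
    where
    size : m G + 2 ≤ 2 * n G
    size = acyclic-size pos (proj₂ ∘ trees)
    wf : WellFormed vertices (map proj₂ (paint S))
    wf = wellFormed (Unique.allFin⁺ (n G)) (λ _ → ∈-allFin _ , ∈-allFin _)
      (subst₂ (λ a b → a + 2 ≤ 2 * b) (sym (trans (length-map proj₂ (paint S)) (length-tabulate _))) (sym (length-tabulate {n = n G} id)) size)
    finish : Balanceable vertices (map proj₂ (paint S)) →
      ∃[ S′ ] ((∀ c → SpanningTree G (colour-class c S′)) × (∀ v → ∣ degree G S′ v - degree G (colour-class false S′) v ∣ ≤ 5))
    finish (T , CT , bal) =
      let T′ , eq , p = ↭-map-inv proj₂ (↭-trans (edges CT) (↭-reflexive (map-tabulate _ proj₂)))
          S′ , eq′ = decode (ends G) T′ (sym eq)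
      in result S′ (subst (T ↭_) eq′ p)
      where
      result : ∀ S′ → T ↭ paint S′ →
        ∃[ S′ ] ((∀ c → SpanningTree G (colour-class c S′)) × (∀ v → ∣ degree G S′ v - degree G (colour-class false S′) v ∣ ≤ 5))
      result S′ p = S′ , (λ c → (λ u v → con-walk (s c (∈-allFin u) (∈-allFin v))) , acyclic c)
                  , λ v → subst₂ (λ a b → ∣ a - b ∣ ≤ 5) (sym (deg true v)) (sym (deg false v)) (close (bal v true) (bal v false))
        where
        s : Spanning vertices (paint S′)
        s = spanning-↭ p (spans CT)
        acyclic : ∀ c → Acyclic G (colour-class c S′)
        acyclic = spanning-acyclic size s
        deg : ∀ c v → degree G (colour-class c S′) v ≡ cdeg T c v
        deg c v = trans (degree-nbs c S′ (ends G) v (λ e eq → no-loops (acyclic c) (subst (λ k → colour-class k S′ e ≡ true) eq (class-complete S′ e)))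
          (colour-class c S′) (class-indicator c S′)) (sym (nbs-↭ v _ p))

  walk-cong : ∀ {S S′ u v es vs} → (∀ e → S e ≡ S′ e) → Walk G S u v es vs → Walk G S′ u v es vs
  walk-cong h stop = stop
  walk-cong h (step e Se j w) = step e (trans (sym (h e)) Se) j (walk-cong h w)

  tree-cong : ∀ {S S′} → (∀ e → S e ≡ S′ e) → SpanningTree G S → SpanningTree G S′
  tree-cong h (con , acyclic) = (λ u v → let es , vs , w = con u v in es , vs , walk-cong h w)
    , λ { (u , e , es , vs , w , un , un′) → acyclic (u , e , es , vs , walk-cong (sym ∘ h) w , un , un′) }

inhabited : ∀ {k} → Fin k → 1 ≤ k
inhabited zero = s≤s z≤n
inhabited (suc _) = s≤s z≤n

theorem2 : (G : Graph) → DoubleTree G →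
    ∃[ T₁ ] ∃[ T₂ ] (IsFactorization₂ G T₁ T₂ ×
      (∀ v → ∣ degree G T₁ v - degree G T₂ v ∣ ≤ 5))
theorem2 G (T₁ , T₂ , tree₁ , tree₂ , opposite) with 1 ≤? n G
... | no n≡0 = T₁ , T₂ , (tree₁ , tree₂ , opposite) , λ v → contradiction (inhabited v) n≡0
... | yes pos =
  let S , trees , bal = balanced-factorization pos T₁ λ { true → tree₁ ; false → tree-cong opposite tree₂ }
  in S , colour-class false S , (trees true , trees false , λ _ → refl) , bal
  where open Conversion G
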